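{- Let $n\ge 4$. For every $\mu=(\mu_1,\ldots,\mu_n)\in\mathbb{Z}_{\ge 0}^n$, the polynomial $x^{\mu}\mathfrak{S}_{1432}(x^{ -1})=x_1^{\mu_1}\cdots x_n^{\mu_n}\,\mathfrak{S}_{1432}(x_1^{ -1},\ldots,x_n^{ -1})$ is not a Schubert polynomial, i.e. it is not equal to $\mathfrak{S}_u(x)$ for any permutation $u$.
   Context: Schubert polynomials: with $\partial_i f=(f-s_if)/(x_i-x_{i+1})$ ($s_i f$ swaps $x_i,x_{i+1}$), for $w_0=m\cdots 21\in S_m$ set $\mathfrak{S}_{w_0}=x_1^{m-1}x_2^{m-2}\cdots x_{m-1}$, and $\mathfrak{S}_w=\partial_i\mathfrak{S}_{ws_i}$ whenever $w_i<w_{i+1}$ ($ws_i$ swaps the entries in positions $i,i+1$); appending fixed points does not change $\mathfrak{S}_w$. In particular $\mathfrak{S}_{1432}(x)=x_1^2x_2+x_1^2x_3+x_1x_2^2+x_1x_2x_3+x_2^2x_3$. -}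

module Defs where

open import Data.Nat as ℕ using (ℕ; zero; suc; _<_; _≤_)
open import Data.Integer as ℤ using (ℤ; +_; -_)
import Data.Integer.Properties as ℤP
open import Data.List using (List; []; _∷_; _++_; map; concatMap; foldr)
import Data.List.Properties as LP
open import Data.Vec using (Vec; toList)
open import Data.Product using (_×_; _,_; ∃; ∃-syntax)
open import Data.Maybe using (Maybe; just; nothing)
open import Relation.Nullary using (yes; no)
open import Relation.Binary.PropositionalEquality using (_≡_)

-- Laurent polynomials in x₁, x₂, … with integer coefficients.
-- A monomial is a finite list of integer exponents (entry k = exponent
-- of x_{k+1}); lists differing by trailing zeros denote the same
-- monomial.  A polynomial is a finite formal sum of terms
-- (coefficient , monomial); two polynomials are equal (≈) iff every
-- monomial has the same total coefficient.

Mono : Set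
Mono = List ℤ

Poly : Set
Poly = List (ℤ × Mono)

strip : Mono → Mono
strip [] = []
strip (x ∷ r) with strip r
... | [] with x ℤ.≟ + 0
...   | yes _ = []
...   | no  _ = x ∷ []
strip (x ∷ r) | y ∷ r' = x ∷ y ∷ r'

coeff : Poly → Mono → ℤ
coeff [] e = + 0
coeff ((c , a) ∷ p) e with LP.≡-dec ℤ._≟_ (strip a) (strip e)
... | yes _ = c ℤ.+ coeff p e
... | no  _ = coeff p e

infix 4 _≈_
_≈_ : Poly → Poly → Set
p ≈ q = ∀ (e : Mono) → coeff p e ≡ coeff q e

addE : Mono → Mono → Mono
addE [] b = b
addE a [] = a
addE (x ∷ a) (y ∷ b) = (x ℤ.+ y) ∷ addE a b

subE : Mono → Mono → Mono
subE a [] = a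
subE [] (y ∷ b) = (- y) ∷ subE [] b
subE (x ∷ a) (y ∷ b) = (x ℤ.- y) ∷ subE a b

_⊕_ : Poly → Poly → Poly
p ⊕ q = p ++ q

neg : Poly → Poly
neg = map (λ { (c , a) → (- c , a) })

_⊖_ : Poly → Poly → Poly
p ⊖ q = p ⊕ neg q

_⊗_ : Poly → Poly → Poly
p ⊗ q = concatMap (λ { (c , a) → map (λ { (d , b) → (c ℤ.* d , addE a b) }) q }) p

unitE : ℕ → Mono
unitE zero = + 1 ∷ []
unitE (suc i) = + 0 ∷ unitE i

-- x_{i+1} - x_{i+2}   (0-based i; paper's x_i - x_{i+1} with i+1)
xdiff : ℕ → Poly
xdiff i = (+ 1 , unitE i) ∷ (- (+ 1) , unitE (suc i)) ∷ []

swapE : ℕ → Mono → Mono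
swapE zero [] = []
swapE zero (x ∷ []) = + 0 ∷ x ∷ []
swapE zero (x ∷ y ∷ r) = y ∷ x ∷ r
swapE (suc i) [] = []
swapE (suc i) (x ∷ r) = x ∷ swapE i r

sPoly : ℕ → Poly → Poly
sPoly i = map (λ { (c , a) → (c , swapE i a) })

IsDivDiff : ℕ → Poly → Poly → Set
IsDivDiff i f g = xdiff i ⊗ g ≈ f ⊖ sPoly i f

-- Permutations in one-line notation (lists of 1..m).

w0 : ℕ → List ℕ
w0 zero = []
w0 (suc m) = suc m ∷ w0 m

at : List ℕ → ℕ → Maybe ℕ
at [] _ = nothing
at (x ∷ _) zero = just x
at (_ ∷ r) (suc i) = at r i

swapL : ℕ → List ℕ → List ℕ
swapL zero (x ∷ y ∷ r) = y ∷ x ∷ r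
swapL zero r = r
swapL (suc i) [] = []
swapL (suc i) (x ∷ r) = x ∷ swapL i r

staircaseE : ℕ → Mono
staircaseE zero = []
staircaseE (suc m) = + m ∷ staircaseE m

staircase : ℕ → Poly
staircase m = (+ 1 , staircaseE m) ∷ []

-- Schubert w P : P is (a representative of) 𝔖_w, following the
-- recursive definition: 𝔖_{w₀} = staircase, and 𝔖_w = ∂_i 𝔖_{ws_i}
-- whenever w_i < w_{i+1}.  Starting from w₀ ∈ S_m for every m covers
-- the convention that appending fixed points does not change 𝔖_w.
data Schubert : List ℕ → Poly → Set where
  top  : ∀ m → Schubert (w0 m) (staircase m)
  step : ∀ (w : List ℕ) (i a b : ℕ) (P Q : Poly) →
         at w i ≡ just a → at w (suc i) ≡ just b → a < b →
         Schubert (swapL i w) Q → IsDivDiff i Q P →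
         Schubert w P

S1432 : Poly
S1432 = (+ 1 , + 2 ∷ + 1 ∷ + 0 ∷ [])
      ∷ (+ 1 , + 2 ∷ + 0 ∷ + 1 ∷ [])
      ∷ (+ 1 , + 1 ∷ + 2 ∷ + 0 ∷ [])
      ∷ (+ 1 , + 1 ∷ + 1 ∷ + 1 ∷ [])
      ∷ (+ 1 , + 0 ∷ + 2 ∷ + 1 ∷ [])
      ∷ []

twist : Mono → Poly → Poly
twist μ = map (λ { (c , a) → (c , subE μ a) })

toMono : ∀ {n} → Vec ℕ n → Mono
toMono v = map +_ (toList v)

{-# OPTIONS --safe #-}

-- By Fomin and Stanley, the Schubert polynomials of S_{N+1} are the coefficients
-- of Π_i Π_{j=N-1,…,i} (1 + x_i u_j) in the nilCoxeter algebra (indices from 0),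
-- because this product turns ∂_i into right multiplication by u_i.  The formula
-- bounds their supports: the degree of 𝔖_w in x_k, x_{k+1}, … is at most the
-- number of inversions of w among the positions ≥ k.  Hence 𝔖_w has the leading monomial
-- x^{code w}, for the order comparing the last exponents first.
--
-- With ν = μ - (2,2,1) the reciprocal polynomial is
-- F = x^ν (x₂x₃ + x₂² + x₁x₃ + x₁x₂ + x₁²), so F = 𝔖_u forces
-- code u = ν + (0,1,1).  As F is not symmetric in x₂ and x₃, u has a descent in
-- position 2 and ∂₂F is the Schubert polynomial of u s₂; but x^ν x₂² contributes
-- to ∂₂F a monomial whose x₃-exponent exceeds the one allowed by code (u s₂).
module Submission where

open import Defs
open import Data.Bool using (Bool; true; false; if_then_else_)
open import Data.Nat as ℕ using (ℕ; zero; suc; _≤_; _<_; z≤n; s≤s; _∸_; _<ᵇ_; _≡ᵇ_)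
import Data.Nat.Properties as ℕP
open import Data.Integer as ℤ using (ℤ; 0ℤ; 1ℤ; _+_; _-_) renaming (+_ to pos)
import Data.Integer.Properties as ℤP
open import Data.Integer.Tactic.RingSolver using (solve-∀)
import Algebra.Properties.AbelianGroup ℤP.+-0-abelianGroup as ℤGroup
open import Data.Empty using (⊥)
open import Data.List using (List; []; _∷_; _++_; map; drop; length)
import Data.List.Properties as LP
open import Data.List.Relation.Unary.All using (All; []; _∷_)
open import Data.List.Relation.Unary.Any using (Any; here; there)
open import Data.Maybe using (just)
open import Data.Product using (_×_; _,_; ∃; proj₁; proj₂)
open import Data.Sum using (_⊎_; inj₁; inj₂)
open import Data.Vec using (Vec; []; _∷_)
open import Function using (id; _∘_)
open import Relation.Nullary using (¬_; yes; no; contradiction)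
open import Relation.Nullary.Decidable using (decidable-stable)
open import Relation.Binary.PropositionalEquality

-- The nilCoxeter algebra and the Fomin–Stanley product

lower : ℕ → Mono → Mono
lower zero    []      = (0ℤ - 1ℤ) ∷ []
lower zero    (x ∷ e) = (x - 1ℤ) ∷ e
lower (suc k) []      = 0ℤ ∷ lower k []
lower (suc k) (x ∷ e) = x ∷ lower k e

-- Unlike swapE, this pads short lists, so that it commutes with lower on
-- the nose and not only up to trailing zeros.
exch : ℕ → Mono → Mono
exch zero    []          = 0ℤ ∷ 0ℤ ∷ []
exch zero    (x ∷ [])    = 0ℤ ∷ x ∷ []
exch zero    (x ∷ y ∷ e) = y ∷ x ∷ e
exch (suc i) []          = 0ℤ ∷ exch i []
exch (suc i) (x ∷ e)     = x ∷ exch i e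

lower-comm : ∀ j k e → lower j (lower k e) ≡ lower k (lower j e)
lower-comm zero    zero    e       = refl
lower-comm zero    (suc k) []      = refl
lower-comm zero    (suc k) (x ∷ e) = refl
lower-comm (suc j) zero    []      = refl
lower-comm (suc j) zero    (x ∷ e) = refl
lower-comm (suc j) (suc k) []      = cong (0ℤ ∷_) (lower-comm j k [])
lower-comm (suc j) (suc k) (x ∷ e) = cong (x ∷_) (lower-comm j k e)

exch-lower-here : ∀ i e → exch i (lower i e) ≡ lower (suc i) (exch i e)
exch-lower-here zero    []          = refl
exch-lower-here zero    (x ∷ [])    = refl
exch-lower-here zero    (x ∷ y ∷ e) = refl
exch-lower-here (suc i) []          = cong (0ℤ ∷_) (exch-lower-here i [])
exch-lower-here (suc i) (x ∷ e)     = cong (x ∷_) (exch-lower-here i e)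

exch-lower-next : ∀ i e → exch i (lower (suc i) e) ≡ lower i (exch i e)
exch-lower-next zero    []          = refl
exch-lower-next zero    (x ∷ [])    = refl
exch-lower-next zero    (x ∷ y ∷ e) = refl
exch-lower-next (suc i) []          = cong (0ℤ ∷_) (exch-lower-next i [])
exch-lower-next (suc i) (x ∷ e)     = cong (x ∷_) (exch-lower-next i e)

exch-lower-before : ∀ {i k} → k < i → ∀ e → exch i (lower k e) ≡ lower k (exch i e)
exch-lower-before {suc i} {zero}  _       []      = refl
exch-lower-before {suc i} {zero}  _       (x ∷ e) = refl
exch-lower-before {suc i} {suc k} (s≤s p) []      = cong (0ℤ ∷_) (exch-lower-before p [])
exch-lower-before {suc i} {suc k} (s≤s p) (x ∷ e) = cong (x ∷_) (exch-lower-before p e)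

exch-lower-after : ∀ {i k} → suc i < k → ∀ e → exch i (lower k e) ≡ lower k (exch i e)
exch-lower-after {zero}  {suc (suc k)} _ []          = refl
exch-lower-after {zero}  {suc (suc k)} _ (x ∷ [])    = refl
exch-lower-after {zero}  {suc (suc k)} _ (x ∷ y ∷ e) = refl
exch-lower-after {zero}  {suc zero} (s≤s ()) e
exch-lower-after {suc i} {suc k} (s≤s p) []          = cong (0ℤ ∷_) (exch-lower-after p [])
exch-lower-after {suc i} {suc k} (s≤s p) (x ∷ e)     = cong (x ∷_) (exch-lower-after p e)

desc : ℕ → List ℕ → Bool
desc zero    (x ∷ y ∷ r) = y <ᵇ x
desc zero    _           = false
desc (suc i) []          = false
desc (suc i) (x ∷ r)     = desc i r

-- An element Σ_w φ_w w of the nilCoxeter algebra over the power series ring,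
-- stored as the coefficients of the φ_w.
Coeffs : Set
Coeffs = List ℕ → Mono → ℤ

infix 4 _≐_
_≐_ : Coeffs → Coeffs → Set
φ ≐ ψ = ∀ w e → φ w e ≡ ψ w e

-- Right multiplication by the generator u_i.
R : ℕ → Coeffs → Coeffs
R i φ w e = if desc i w then φ (swapL i w) e else 0ℤ

-- Multiplication by x_k: the coefficient of `e` in x_k φ is that of `e` with one x_k removed.
X : ℕ → Coeffs → Coeffs
X k φ w e = φ w (lower k e)

infixl 6 _⊞_
_⊞_ : Coeffs → Coeffs → Coeffs
(φ ⊞ ψ) w e = φ w e + ψ w e

-- Right multiplication by 1 + x_k u_i.
H : ℕ → ℕ → Coeffs → Coeffs
H i k φ = φ ⊞ X k (R i φ)

-- Right multiplication by (1 + x_k u_{i+n-1}) ⋯ (1 + x_k u_i).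
A : ℕ → ℕ → ℕ → Coeffs → Coeffs
A i zero    k φ = φ
A i (suc n) k φ = H i k (A (suc i) n k φ)

-- Right multiplication by the factors of the Fomin–Stanley product
-- belonging to x_i, x_{i+1}, …, x_{i+n-1}.
S : ℕ → ℕ → Coeffs → Coeffs
S i zero    φ = φ
S i (suc n) φ = S (suc i) n (A i (suc n) i φ)

-- Relations of the nilCoxeter algebra

R-cong : ∀ i {φ ψ} → φ ≐ ψ → R i φ ≐ R i ψ
R-cong i p w e with desc i w
... | true  = p (swapL i w) e
... | false = refl

R-⊞ : ∀ i φ ψ → R i (φ ⊞ ψ) ≐ R i φ ⊞ R i ψ
R-⊞ i φ ψ w e with desc i w
... | true  = refl
... | false = refl

H-cong : ∀ i k {φ ψ} → φ ≐ ψ → H i k φ ≐ H i k ψ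
H-cong i k p w e = cong₂ _+_ (p w e) (R-cong i p w (lower k e))

<ᵇ-asym : ∀ x y → (x <ᵇ y) ≡ true → (y <ᵇ x) ≡ false
<ᵇ-asym zero    (suc y) _ = refl
<ᵇ-asym (suc x) (suc y) p = <ᵇ-asym x y p

R-square : ∀ i φ w e → R i (R i φ) w e ≡ 0ℤ
R-square zero φ []          e = refl
R-square zero φ (x ∷ [])    e = refl
R-square zero φ (x ∷ y ∷ r) e with y <ᵇ x in eq
... | false = refl
... | true rewrite <ᵇ-asym y x eq = refl
R-square (suc i) φ []      e = refl
R-square (suc i) φ (x ∷ r) e = R-square i (λ r → φ (x ∷ r)) r e

-- Both sides make the same three comparisons, in opposite orders, and then reverse the three
-- entries.
R-braid : ∀ i φ → R i (R (suc i) (R i φ)) ≐ R (suc i) (R i (R (suc i) φ))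
R-braid zero φ []       e = refl
R-braid zero φ (x ∷ []) e = refl
R-braid zero φ (x ∷ y ∷ []) e with y <ᵇ x
... | true  = refl
... | false = refl
R-braid zero φ (x ∷ y ∷ z ∷ r) e
  with y <ᵇ x | z <ᵇ x | z <ᵇ y
... | true  | true  | true  = refl
... | true  | true  | false = refl
... | true  | false | true  = refl
... | true  | false | false = refl
... | false | true  | true  = refl
... | false | true  | false = refl
... | false | false | true  = refl
... | false | false | false = refl
R-braid (suc i) φ []      e = refl
R-braid (suc i) φ (x ∷ r) e = R-braid i (λ r → φ (x ∷ r)) r e

R-far : ∀ {i j} → suc i < j → ∀ φ → R i (R j φ) ≐ R j (R i φ)
R-far {zero} {suc zero} (s≤s ()) φ
R-far {zero} {suc (suc j)} _ φ []       e = refl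
R-far {zero} {suc (suc j)} _ φ (x ∷ []) e = refl
R-far {zero} {suc (suc j)} _ φ (x ∷ y ∷ r) e with y <ᵇ x | desc j r
... | true  | true  = refl
... | true  | false = refl
... | false | true  = refl
... | false | false = refl
R-far {suc i} {suc j} (s≤s p) φ []      e = refl
R-far {suc i} {suc j} (s≤s p) φ (x ∷ r) e = R-far p (λ r → φ (x ∷ r)) r e

-- Generators at distance at least two commute, so 1 + x u_i slides past a row that starts beyond
-- u_{i+1}.
H-A-far : ∀ {i j} → suc i < j → ∀ n x y φ → H i x (A j n y φ) ≐ A j n y (H i x φ)
H-A-far p zero    x y φ w e = refl
H-A-far {i} {j} p (suc n) x y φ w e = trans (swapH w e)
  (H-cong j y (H-A-far (ℕP.m<n⇒m<1+n p) n x y φ) w e)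
  where
  open ≡-Reasoning
  ψ = A (suc j) n y φ
  rearrange : ∀ (a b c d : ℤ) → a + b + (c + d) ≡ a + c + (b + d)
  rearrange = solve-∀
  swapH : H i x (H j y ψ) ≐ H j y (H i x ψ)
  swapH w e = begin
    ψ w e + R j ψ w (lower y e) + R i (H j y ψ) w (lower x e)
      ≡⟨ cong (ψ w e + R j ψ w (lower y e) +_) (R-⊞ i ψ (X y (R j ψ)) w (lower x e)) ⟩
    ψ w e + R j ψ w (lower y e) + (R i ψ w (lower x e) + R i (R j ψ) w (lower y (lower x e)))
      ≡⟨ rearrange (ψ w e) (R j ψ w (lower y e)) (R i ψ w (lower x e)) _ ⟩
    ψ w e + R i ψ w (lower x e) + (R j ψ w (lower y e) + R i (R j ψ) w (lower y (lower x e)))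
      ≡⟨ cong (λ t → ψ w e + R i ψ w (lower x e) + (R j ψ w (lower y e) + t))
           (trans (R-far p ψ w _) (cong (R j (R i ψ) w) (lower-comm y x e))) ⟩
    ψ w e + R i ψ w (lower x e) + (R j ψ w (lower y e) + R j (R i ψ) w (lower x (lower y e)))
      ≡⟨ cong (ψ w e + R i ψ w (lower x e) +_) (R-⊞ j ψ (X x (R i ψ)) w (lower y e)) ⟨
    H j y (H i x ψ) w e ∎

-- Right multiplication by 1 + (x + y) u_i + x y (u_i u_{i+1} - u_{i+1} u_i).
G : ℕ → ℕ → ℕ → Coeffs → Coeffs
G i x y φ w e =
  φ w e + (R i φ w (lower x e) + R i φ w (lower y e))
        + (R (suc i) (R i φ) w (lower x (lower y e)) - R i (R (suc i) φ) w (lower x (lower y e)))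

G-sym : ∀ i x y φ → G i x y φ ≐ G i y x φ
G-sym i x y φ w e rewrite lower-comm x y e =
  cong (λ t → φ w e + t + (R (suc i) (R i φ) w (lower y (lower x e))
                          - R i (R (suc i) φ) w (lower y (lower x e))))
    (ℤP.+-comm (R i φ w (lower x e)) (R i φ w (lower y e)))

G-cong : ∀ i x y {φ ψ} → φ ≐ ψ → G i x y φ ≐ G i x y ψ
G-cong i x y p w e = cong₂ _+_
  (cong₂ _+_ (p w e) (cong₂ _+_ (R-cong i p w _) (R-cong i p w _)))
  (cong₂ _-_ (R-cong (suc i) (R-cong i p) w _) (R-cong i (R-cong (suc i) p) w _))

-- A form of the Yang-Baxter equation: 1 + y u_{i+1} moves to the far left, and what remains is the
-- factor `G`, symmetric in x and y by `G-sym`.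
yang-baxter : ∀ i x y ψ → H i y (H (suc i) y (H i x ψ)) ≐ G i x y (H (suc i) y ψ)
yang-baxter i x y ψ w e = begin
  ψ w e + a w Dx + R j (H i x ψ) w Dy + R i (H j y (H i x ψ)) w Dy
    ≡⟨ cong₂ (λ s t → ψ w e + a w Dx + s + t) (R-⊞ j ψ (X x a) w Dy) (expand w Dy) ⟩
  ψ w e + a w Dx + (b w Dy + ba w Dxy)
    + (a w Dy + R i a w (lower x Dy) + (ab w (lower y Dy) + R i ba w (lower x (lower y Dy))))
    -- u_i² = 0 removes one term, and the braid relation turns u_i u_{i+1} u_i into u_{i+1} u_i
    -- u_{i+1}, the only cubic term on the other side.
    ≡⟨ cong₂ (λ s t → ψ w e + a w Dx + (b w Dy + ba w Dxy) + (a w Dy + s + (ab w Dyy + t)))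
         (R-square i ψ w _)
         (trans (R-braid i ψ w _) (cong (R j ab w) (lower-comm x y Dy))) ⟩
  ψ w e + a w Dx + (b w Dy + ba w Dxy) + (a w Dy + 0ℤ + (ab w Dyy + R j ab w (lower y Dxy)))
    ≡⟨ rearrange (ψ w e) (a w Dx) (b w Dy) (ba w Dxy) (a w Dy) (ab w Dyy) (R j ab w (lower y Dxy)) (ab w Dxy) ⟩
  ψ w e + b w Dy + (a w Dx + ab w Dxy + (a w Dy + ab w Dyy))
    + (ba w Dxy + R j ab w (lower y Dxy) - (ab w Dxy + 0ℤ))
    ≡⟨ cong₂ (λ s t → ψ w e + b w Dy + (a w Dx + s + (a w Dy + ab w Dyy))
                      + (ba w Dxy + R j ab w (lower y Dxy) - (ab w Dxy + t)))
         (cong (ab w) (lower-comm x y e)) (sym (bb w (lower y Dxy))) ⟩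
  ψ w e + b w Dy + (a w Dx + ab w (lower y Dx) + (a w Dy + ab w Dyy))
    + (ba w Dxy + R j ab w (lower y Dxy) - (ab w Dxy + R i (R j b) w (lower y Dxy)))
    ≡⟨ cong₂ (λ s t → ψ w e + b w Dy + s + t)
         (cong₂ _+_ (R-⊞ i ψ (X y b) w Dx) (R-⊞ i ψ (X y b) w Dy))
         (cong₂ _-_ (R² j i (X y b) Dxy) (R² i j (X y b) Dxy)) ⟨
  G i x y (H j y ψ) w e ∎
  where
  open ≡-Reasoning
  j = suc i
  a = R i ψ
  b = R j ψ
  ba = R j a
  ab = R i b
  Dx = lower x e
  Dy = lower y e
  Dxy = lower x Dy
  Dyy = lower y Dy
  R² : ∀ p q χ e → R p (R q (ψ ⊞ χ)) w e ≡ R p (R q ψ) w e + R p (R q χ) w e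
  R² p q χ e = trans (R-cong p (R-⊞ q ψ χ) w e) (R-⊞ p (R q ψ) (R q χ) w e)
  bb : ∀ w e → R i (R j b) w e ≡ 0ℤ
  bb w e with desc i w
  ... | true  = R-square j ψ (swapL i w) e
  ... | false = refl
  expand : ∀ w e → R i (H j y (H i x ψ)) w e ≡
    a w e + R i a w (lower x e) + (ab w (lower y e) + R i ba w (lower x (lower y e)))
  expand w e = trans (R-⊞ i (H i x ψ) (X y (R j (H i x ψ))) w e)
    (cong₂ _+_ (R-⊞ i ψ (X x a) w e)
      (trans (R-cong i (R-⊞ j ψ (X x a)) w (lower y e)) (R-⊞ i b (X x ba) w (lower y e))))
  rearrange : ∀ (p ax by bax ay abyy bab abx : ℤ) →
    p + ax + (by + bax) + (ay + 0ℤ + (abyy + bab)) ≡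
    p + by + (ax + abx + (ay + abyy)) + (bax + bab - (abx + 0ℤ))
  rearrange = solve-∀

-- Induction on the row length: two rows of at least two factors equal two shorter rows followed by
-- `G`; the shorter rows commute, and `G` is symmetric.
A-comm : ∀ i n x y φ → A i n y (A i n x φ) ≐ A i n x (A i n y φ)
A-comm i zero          x y φ w e = refl
A-comm i (suc zero)    x y φ w e = begin
  φ w e + a w Dx + R i (H i x φ) w Dy
    ≡⟨ cong (φ w e + a w Dx +_) (absorb x Dy) ⟩
  φ w e + a w Dx + (a w Dy + 0ℤ)
    ≡⟨ rearrange (φ w e) (a w Dx) (a w Dy) ⟩
  φ w e + a w Dy + (a w Dx + 0ℤ)
    ≡⟨ cong (φ w e + a w Dy +_) (absorb y Dx) ⟨
  φ w e + a w Dy + R i (H i y φ) w Dx ∎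
  where
  open ≡-Reasoning
  a = R i φ
  Dx = lower x e
  Dy = lower y e
  absorb : ∀ k e → R i (H i k φ) w e ≡ a w e + 0ℤ
  absorb k e = trans (R-⊞ i φ (X k a) w e) (cong (a w e +_) (R-square i φ w _))
  rearrange : ∀ (p q r : ℤ) → p + q + (r + 0ℤ) ≡ p + r + (q + 0ℤ)
  rearrange = solve-∀
A-comm i (suc (suc n)) x y φ w e = begin
  A i (2 ℕ.+ n) y (A i (2 ℕ.+ n) x φ) w e
    ≡⟨ two-rows x y w e ⟩
  G i x y (A (suc i) (suc n) y (A (suc i) (suc n) x φ)) w e
    ≡⟨ G-cong i x y (A-comm (suc i) (suc n) x y φ) w e ⟩
  G i x y (A (suc i) (suc n) x (A (suc i) (suc n) y φ)) w e
    ≡⟨ G-sym i x y (A (suc i) (suc n) x (A (suc i) (suc n) y φ)) w e ⟩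
  G i y x (A (suc i) (suc n) x (A (suc i) (suc n) y φ)) w e
    ≡⟨ two-rows y x w e ⟨
  A i (2 ℕ.+ n) x (A i (2 ℕ.+ n) y φ) w e ∎
  where
  open ≡-Reasoning
  two-rows : ∀ x y → A i (2 ℕ.+ n) y (A i (2 ℕ.+ n) x φ) ≐
                     G i x y (A (suc i) (suc n) y (A (suc i) (suc n) x φ))
  two-rows x y w e = trans
    -- The factor 1 + x u_i slides past the factors of index at least i+2 of the second row and
    -- meets 1 + y u_{i+1}, where `yang-baxter` applies.
    (H-cong i y (H-cong (suc i) y (λ w e → sym (H-A-far ℕP.≤-refl n x y ψ w e))) w e)
    (yang-baxter i x y (A (2 ℕ.+ i) n y ψ) w e)
    where ψ = A (suc i) (suc n) x φ

-- Symmetry and the divided-difference relation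

Sym : ℕ → Coeffs → Set
Sym i φ = ∀ w e → φ w (exch i e) ≡ φ w e

-- ∂_i φ = φ u_i, without the division.
Div : ℕ → Coeffs → Set
Div i φ = ∀ w e → φ w e - φ w (exch i e) ≡ R i φ w (lower i e) - R i φ w (lower (suc i) e)

R-exch : ∀ i j {φ ψ : Coeffs} → (∀ w e → φ w (exch i e) ≡ ψ w e) →
  ∀ w e → R j φ w (exch i e) ≡ R j ψ w e
R-exch i j p w e with desc j w
... | true  = p (swapL j w) e
... | false = refl

-- The exchange acts on coefficients alone, so it passes through every u_j and only changes the
-- variable of the row.
A-exch : ∀ i j n k k′ → (∀ e → lower k (exch i e) ≡ exch i (lower k′ e)) →
  ∀ {φ ψ : Coeffs} → (∀ w e → φ w (exch i e) ≡ ψ w e) →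
  ∀ w e → A j n k φ w (exch i e) ≡ A j n k′ ψ w e
A-exch i j zero    k k′ l p = p
A-exch i j (suc n) k k′ l {φ} {ψ} p w e = cong₂ _+_ (q w e)
  (trans (cong (R j (A (suc j) n k φ) w) (l e)) (R-exch i j {A (suc j) n k φ} q w (lower k′ e)))
  where q = A-exch i (suc j) n k k′ l p

Sym-A : ∀ {i k} → k < i → ∀ j n φ → Sym i φ → Sym i (A j n k φ)
Sym-A {i} {k} p j n φ = A-exch i j n k k (λ e → sym (exch-lower-before p e))

-- x_k is fixed by the exchange of x_i and x_{i+1}, and u_j commutes with u_i.
Div-H : ∀ {i j k} → suc i < j → suc i < k → ∀ φ → Div i φ → Div i (H j k φ)
Div-H {i} {j} {k} p q φ d w e = begin
  φ w e + R j φ w (lower k e) - (φ w (exch i e) + R j φ w (lower k (exch i e)))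
    ≡⟨ rearrange (φ w e) (R j φ w (lower k e)) (φ w (exch i e)) _ ⟩
  (φ w e - φ w (exch i e)) + (R j φ w (lower k e) - R j φ w (lower k (exch i e)))
    ≡⟨ cong₂ _+_ (d w e)
         (trans (cong (λ t → R j φ w (lower k e) - R j φ w t) (sym (exch-lower-after q e)))
                (Div-R w (lower k e))) ⟩
  (a w (lower i e) - a w (lower (suc i) e))
    + (R i (R j φ) w (lower i (lower k e)) - R i (R j φ) w (lower (suc i) (lower k e)))
    ≡⟨ cong₂ (λ s t → (a w (lower i e) - a w (lower (suc i) e)) + (R i (R j φ) w s - R i (R j φ) w t))
         (lower-comm i k e) (lower-comm (suc i) k e) ⟩
  (a w (lower i e) - a w (lower (suc i) e))
    + (R i (R j φ) w (lower k (lower i e)) - R i (R j φ) w (lower k (lower (suc i) e)))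
    ≡⟨ rearrange (a w (lower i e)) (R i (R j φ) w (lower k (lower i e))) (a w (lower (suc i) e)) _ ⟨
  (a w (lower i e) + R i (R j φ) w (lower k (lower i e)))
    - (a w (lower (suc i) e) + R i (R j φ) w (lower k (lower (suc i) e)))
    ≡⟨ cong₂ _-_ (R-⊞ i φ (X k (R j φ)) w (lower i e)) (R-⊞ i φ (X k (R j φ)) w (lower (suc i) e)) ⟨
  R i (H j k φ) w (lower i e) - R i (H j k φ) w (lower (suc i) e) ∎
  where
  open ≡-Reasoning
  a = R i φ
  rearrange : ∀ (p q r s : ℤ) → p + q - (r + s) ≡ (p - r) + (q - s)
  rearrange = solve-∀
  R-Div : ∀ w e → R j φ w e - R j φ w (exch i e) ≡
    R j (R i φ) w (lower i e) - R j (R i φ) w (lower (suc i) e)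
  R-Div w e with desc j w
  ... | true  = d (swapL j w) e
  ... | false = refl
  Div-R : Div i (R j φ)
  Div-R w e = trans (R-Div w e)
    (sym (cong₂ _-_ (R-far p φ w (lower i e)) (R-far p φ w (lower (suc i) e))))

Div-A : ∀ {i j k} → suc i < j → suc i < k → ∀ n φ → Div i φ → Div i (A j n k φ)
Div-A p q zero    φ d = d
Div-A {i} {j} {k} p q (suc n) φ d =
  Div-H p q (A (suc j) n k φ) (Div-A (ℕP.m<n⇒m<1+n p) q n φ d)

Div-S : ∀ {i j} → suc i < j → ∀ n φ → Div i φ → Div i (S j n φ)
Div-S p zero    φ d = d
Div-S {i} {j} p (suc n) φ d =
  Div-S (ℕP.m<n⇒m<1+n p) n (A j (suc n) j φ) (Div-A p p (suc n) φ d)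

-- Multiplying the product of the rows i and i+1 by 1 + x_{i+1} u_i makes it
-- symmetric in x_i and x_{i+1}.
Div-two-rows : ∀ i n φ → Sym i φ → Div i (A (suc i) n (suc i) (A i (suc n) i φ))
Div-two-rows i n φ s w e = begin
  B w e - B w (exch i e)
    ≡⟨ cong₂ _-_ (complete w e) (complete w (exch i e)) ⟩
  Z w e - R i B w (lower (suc i) e) - (Z w (exch i e) - R i B w (lower (suc i) (exch i e)))
    ≡⟨ cong₂ (λ s t → Z w e - R i B w (lower (suc i) e) - (s - t)) (Z-sym w e)
         (trans (cong (R i B w) (sym (exch-lower-here i e))) (RB-sym w (lower i e))) ⟩
  Z w e - R i B w (lower (suc i) e) - (Z w e - R i B w (lower i e))
    ≡⟨ rearrange (Z w e) _ _ ⟩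
  R i B w (lower i e) - R i B w (lower (suc i) e) ∎
  where
  open ≡-Reasoning
  B = A (suc i) n (suc i) (A i (suc n) i φ)
  Z = A i (suc n) (suc i) (A i (suc n) i φ)
  cancel : ∀ (p q : ℤ) → p ≡ p + q - q
  cancel = solve-∀
  complete : ∀ w e → B w e ≡ Z w e - R i B w (lower (suc i) e)
  complete w e = cancel (B w e) (R i B w (lower (suc i) e))
  rearrange : ∀ (p q r : ℤ) → p - q - (p - r) ≡ r - q
  rearrange = solve-∀
  -- The exchange swaps the variables of the two full rows; `A-comm` restores their order.
  Z-sym : Sym i Z
  Z-sym w e = trans
    (A-exch i i (suc n) (suc i) i (λ e → sym (exch-lower-here i e))
      (A-exch i i (suc n) i (suc i) (λ e → sym (exch-lower-next i e)) s) w e)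
    (A-comm i (suc n) (suc i) i φ w e)
  -- As Z = B (1 + x_{i+1} u_i) and u_i² = 0, B u_i equals Z u_i and inherits the symmetry of `Z`.
  RZ : R i Z ≐ R i B
  RZ w e = trans (R-⊞ i B (X (suc i) (R i B)) w e)
    (trans (cong (R i B w e +_) (R-square i B w _)) (ℤP.+-identityʳ _))
  RB-sym : Sym i (R i B)
  RB-sym w e = trans (sym (RZ w (exch i e))) (trans (R-exch i i {Z} Z-sym w e) (RZ w e))

-- With i = t + j, the rows before x_i keep the symmetry in x_i and x_{i+1}, the rows of x_i and
-- x_{i+1} create the relation, and the later rows preserve it.
Div-rows : ∀ j t n φ → Sym (t ℕ.+ j) φ → t < n → Div (t ℕ.+ j) (S j n φ)
Div-rows j zero    (suc zero)    φ s p = Div-two-rows j 0 φ s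
Div-rows j zero    (suc (suc n)) φ s p =
  Div-S ℕP.≤-refl n _ (Div-two-rows j (suc n) φ s)
Div-rows j (suc t) (suc n) φ s (s≤s p) =
  subst (λ i → Div i (S (suc j) n (A j (suc n) j φ))) (ℕP.+-suc t j)
    (Div-rows (suc j) t n (A j (suc n) j φ)
      (subst (λ i → Sym i (A j (suc n) j φ)) (sym (ℕP.+-suc t j))
        (Sym-A (s≤s (ℕP.m≤n+m j t)) j (suc n) φ s)) p)

-- Coefficients of Laurent polynomials

get : Mono → ℕ → ℤ
get []      k       = 0ℤ
get (x ∷ e) zero    = x
get (x ∷ e) (suc k) = get e k

infix 4 _∼_
-- Wrapping the equation in a record lets both monomials be inferred from a proof.
record _∼_ (a b : Mono) : Set where
  constructor same
  field strips : strip a ≡ strip b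
open _∼_

get-strip : ∀ e k → get (strip e) k ≡ get e k
get-strip []      k = refl
get-strip (x ∷ r) k with strip r | get-strip r
... | y ∷ r′ | ih = cons k
  where
  cons : ∀ k → get (x ∷ y ∷ r′) k ≡ get (x ∷ r) k
  cons zero    = refl
  cons (suc k) = ih k
... | [] | ih with x ℤ.≟ 0ℤ
...   | yes x≡0 = nil k
  where
  nil : ∀ k → 0ℤ ≡ get (x ∷ r) k
  nil zero    = sym x≡0
  nil (suc k) = ih k
...   | no _ = single k
  where
  single : ∀ k → get (x ∷ []) k ≡ get (x ∷ r) k
  single zero    = refl
  single (suc k) = ih k

∼⇒get : ∀ {a b} → a ∼ b → ∀ k → get a k ≡ get b k
∼⇒get {a} {b} p k = trans (sym (get-strip a k)) (trans (cong (λ t → get t k) (strips p)) (get-strip b k))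

∼-sym : ∀ {a b} → a ∼ b → b ∼ a
∼-sym p = same (sym (strips p))

∼-trans : ∀ {a b c} → a ∼ b → b ∼ c → a ∼ c
∼-trans p q = same (trans (strips p) (strips q))

∼-cons : ∀ x {a b} → a ∼ b → x ∷ a ∼ x ∷ b
∼-cons x {a} {b} (same p) = same (lemma p)
  where
  lemma : strip a ≡ strip b → strip (x ∷ a) ≡ strip (x ∷ b)
  lemma p with strip a | strip b | p
  ... | s | .s | refl = refl

∼-zeros : ∀ a → (∀ k → get a k ≡ 0ℤ) → a ∼ []
∼-zeros []      p = same refl
∼-zeros (x ∷ a) p with refl ← p 0 = ∼-trans (∼-cons 0ℤ (∼-zeros a (p ∘ suc))) (same refl)

-- Reduces equality up to trailing zeros to arithmetic on single exponents.
get⇒∼ : ∀ {a b} → (∀ k → get a k ≡ get b k) → a ∼ b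
get⇒∼ {[]}    {b}     p = ∼-sym (∼-zeros b (sym ∘ p))
get⇒∼ {x ∷ a} {[]}    p = ∼-zeros (x ∷ a) p
get⇒∼ {x ∷ a} {y ∷ b} p with refl ← p 0 = ∼-cons x (get⇒∼ (p ∘ suc))

transpose : ℕ → ℕ → ℕ
transpose zero    zero          = 1
transpose zero    (suc zero)    = 0
transpose zero    (suc (suc k)) = suc (suc k)
transpose (suc i) zero          = 0
transpose (suc i) (suc k)       = suc (transpose i k)

transpose-involutive : ∀ i k → transpose i (transpose i k) ≡ k
transpose-involutive zero    zero          = refl
transpose-involutive zero    (suc zero)    = refl
transpose-involutive zero    (suc (suc k)) = refl
transpose-involutive (suc i) zero          = refl
transpose-involutive (suc i) (suc k)       = cong suc (transpose-involutive i k)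

get-exch : ∀ i e k → get (exch i e) k ≡ get e (transpose i k)
get-exch zero []          zero          = refl
get-exch zero []          (suc zero)    = refl
get-exch zero []          (suc (suc k)) = refl
get-exch zero (x ∷ [])    zero          = refl
get-exch zero (x ∷ [])    (suc zero)    = refl
get-exch zero (x ∷ [])    (suc (suc k)) = refl
get-exch zero (x ∷ y ∷ e) zero          = refl
get-exch zero (x ∷ y ∷ e) (suc zero)    = refl
get-exch zero (x ∷ y ∷ e) (suc (suc k)) = refl
get-exch (suc i) []       zero          = refl
get-exch (suc i) []       (suc k)       = get-exch i [] k
get-exch (suc i) (x ∷ e)  zero          = refl
get-exch (suc i) (x ∷ e)  (suc k)       = get-exch i e k

get-swapE : ∀ i e k → get (swapE i e) k ≡ get e (transpose i k)
get-swapE zero []          k             = refl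
get-swapE zero (x ∷ [])    zero          = refl
get-swapE zero (x ∷ [])    (suc zero)    = refl
get-swapE zero (x ∷ [])    (suc (suc k)) = refl
get-swapE zero (x ∷ y ∷ e) zero          = refl
get-swapE zero (x ∷ y ∷ e) (suc zero)    = refl
get-swapE zero (x ∷ y ∷ e) (suc (suc k)) = refl
get-swapE (suc i) []       k             = refl
get-swapE (suc i) (x ∷ e)  zero          = refl
get-swapE (suc i) (x ∷ e)  (suc k)       = get-swapE i e k

get-addE : ∀ a b k → get (addE a b) k ≡ get a k + get b k
get-addE []      b       k       = sym (ℤP.+-identityˡ _)
get-addE (x ∷ a) []      k       = sym (ℤP.+-identityʳ _)
get-addE (x ∷ a) (y ∷ b) zero    = refl
get-addE (x ∷ a) (y ∷ b) (suc k) = get-addE a b k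

get-lower : ∀ i e k → get (lower i e) k ≡ get e k - get (unitE i) k
get-lower zero    []      zero    = refl
get-lower zero    []      (suc k) = refl
get-lower zero    (x ∷ e) zero    = refl
get-lower zero    (x ∷ e) (suc k) = sym (ℤP.+-identityʳ _)
get-lower (suc i) []      zero    = refl
get-lower (suc i) []      (suc k) = get-lower i [] k
get-lower (suc i) (x ∷ e) zero    = sym (ℤP.+-identityʳ _)
get-lower (suc i) (x ∷ e) (suc k) = get-lower i e k

get-unitE-≡ : ∀ i → get (unitE i) i ≡ 1ℤ
get-unitE-≡ zero    = refl
get-unitE-≡ (suc i) = get-unitE-≡ i

get-unitE-≢ : ∀ {i k} → i ≢ k → get (unitE i) k ≡ 0ℤ
get-unitE-≢ {zero}  {zero}  p = contradiction refl p
get-unitE-≢ {zero}  {suc k} p = refl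
get-unitE-≢ {suc i} {zero}  p = refl
get-unitE-≢ {suc i} {suc k} p = get-unitE-≢ (p ∘ cong suc)

get-lower-≡ : ∀ i e → get (lower i e) i ≡ get e i - 1ℤ
get-lower-≡ i e = trans (get-lower i e i) (cong (get e i -_) (get-unitE-≡ i))

get-lower-≢ : ∀ {i k} → i ≢ k → ∀ e → get (lower i e) k ≡ get e k
get-lower-≢ {i} {k} p e = trans (get-lower i e k)
  (trans (cong (get e k -_) (get-unitE-≢ p)) (ℤP.+-identityʳ _))

lower-∼ : ∀ k {a b} → a ∼ b → lower k a ∼ lower k b
lower-∼ k {a} {b} p = get⇒∼ λ j → trans (get-lower k a j)
  (trans (cong (_- get (unitE k) j) (∼⇒get p j)) (sym (get-lower k b j)))

exch-exch-∼ : ∀ i e → exch i (exch i e) ∼ e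
exch-exch-∼ i e = get⇒∼ λ k → trans (get-exch i (exch i e) k)
  (trans (get-exch i e (transpose i k)) (cong (get e) (transpose-involutive i k)))

exch-∼ : ∀ i {a b} → a ∼ b → exch i a ∼ exch i b
exch-∼ i {a} {b} p = get⇒∼ λ k → trans (get-exch i a k)
  (trans (∼⇒get p (transpose i k)) (sym (get-exch i b k)))

swapE-∼-exch : ∀ i a → swapE i a ∼ exch i a
swapE-∼-exch i a = get⇒∼ λ k → trans (get-swapE i a k) (sym (get-exch i a k))

addE-unitE-lower : ∀ i e → addE (unitE i) (lower i e) ∼ e
addE-unitE-lower i e = get⇒∼ λ k → trans (get-addE (unitE i) (lower i e) k)
  (trans (cong (get (unitE i) k +_) (get-lower i e k)) (cancel (get (unitE i) k) (get e k)))
  where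
  cancel : ∀ (u x : ℤ) → u + (x - u) ≡ x
  cancel = solve-∀

lower-addE-unitE : ∀ i e → lower i (addE (unitE i) e) ∼ e
lower-addE-unitE i e = get⇒∼ λ k → trans (get-lower i (addE (unitE i) e) k)
  (trans (cong (_- get (unitE i) k) (get-addE (unitE i) e k)) (cancel (get (unitE i) k) (get e k)))
  where
  cancel : ∀ (u x : ℤ) → u + x - u ≡ x
  cancel = solve-∀

coeff-∼ : ∀ p {e e′} → e ∼ e′ → coeff p e ≡ coeff p e′
coeff-∼ []            q = refl
coeff-∼ ((c , a) ∷ p) {e} {e′} q
  with LP.≡-dec ℤ._≟_ (strip a) (strip e) | LP.≡-dec ℤ._≟_ (strip a) (strip e′)
... | yes _ | yes _ = cong (c +_) (coeff-∼ p q)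
... | no  _ | no  _ = coeff-∼ p q
... | yes y | no ¬y = contradiction (trans y (strips q)) ¬y
... | no ¬y | yes y = contradiction (trans y (sym (strips q))) ¬y

coeff-++ : ∀ p q e → coeff (p ++ q) e ≡ coeff p e + coeff q e
coeff-++ []            q e = sym (ℤP.+-identityˡ _)
coeff-++ ((c , a) ∷ p) q e with LP.≡-dec ℤ._≟_ (strip a) (strip e)
... | yes _ = trans (cong (c +_) (coeff-++ p q e)) (sym (ℤP.+-assoc c _ _))
... | no  _ = coeff-++ p q e

-- Serves negation, exchange of variables and multiplication by a monomial alike: by `to` and
-- `from`, the terms landing on `e` are exactly those at `e′`.
coeff-map : ∀ (f : ℤ × Mono → ℤ × Mono) (g : ℤ → ℤ) (h : Mono → Mono) →
  (∀ c a → f (c , a) ≡ (g c , h a)) → g 0ℤ ≡ 0ℤ → (∀ x y → g (x + y) ≡ g x + g y) →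
  ∀ e e′ → (∀ {a} → h a ∼ e → a ∼ e′) → (∀ {a} → a ∼ e′ → h a ∼ e) →
  ∀ p → coeff (map f p) e ≡ g (coeff p e′)
coeff-map f g h fe g0 g+ e e′ to from [] = sym g0
coeff-map f g h fe g0 g+ e e′ to from ((c , a) ∷ p) rewrite fe c a
  with LP.≡-dec ℤ._≟_ (strip (h a)) (strip e) | LP.≡-dec ℤ._≟_ (strip a) (strip e′)
... | yes _ | yes _ = trans (cong (g c +_) (coeff-map f g h fe g0 g+ e e′ to from p)) (sym (g+ c _))
... | yes x | no ¬y = contradiction (strips (to (same x))) ¬y
... | no ¬x | yes y = contradiction (strips (from (same y))) ¬x
... | no _  | no _  = coeff-map f g h fe g0 g+ e e′ to from p

coeff-neg : ∀ p e → coeff (neg p) e ≡ ℤ.- coeff p e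
coeff-neg p e = coeff-map _ ℤ.-_ id (λ _ _ → refl) refl ℤP.neg-distrib-+ e e id id p

coeff-sPoly : ∀ i p e → coeff (sPoly i p) e ≡ coeff p (exch i e)
coeff-sPoly i p e = coeff-map _ id (swapE i) (λ _ _ → refl) refl (λ _ _ → refl) e (exch i e)
  (λ {a} q → ∼-trans (∼-sym (exch-exch-∼ i a)) (exch-∼ i (∼-trans (∼-sym (swapE-∼-exch i a)) q)))
  (λ {a} q → ∼-trans (swapE-∼-exch i a) (∼-trans (exch-∼ i q) (exch-exch-∼ i e))) p

coeff-shift : ∀ (c : ℤ) i f → (∀ d b → f (d , b) ≡ (c ℤ.* d , addE (unitE i) b)) →
  ∀ p e → coeff (map f p) e ≡ c ℤ.* coeff p (lower i e)
coeff-shift c i f fe p e = coeff-map f (c ℤ.*_) (addE (unitE i)) fe (ℤP.*-zeroʳ c)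
  (ℤP.*-distribˡ-+ c) e (lower i e)
  (λ {a} q → ∼-trans (∼-sym (lower-addE-unitE i a)) (lower-∼ i q))
  (λ {a} q → get⇒∼ λ k → trans (get-addE (unitE i) a k)
    (trans (cong (get (unitE i) k +_) (∼⇒get q k))
      (trans (sym (get-addE (unitE i) (lower i e) k))
             (∼⇒get (addE-unitE-lower i e) k)))) p

coeff-xdiff : ∀ i p e → coeff (xdiff i ⊗ p) e ≡ coeff p (lower i e) - coeff p (lower (suc i) e)
coeff-xdiff i p e = trans (coeff-++ (map _ p) _ e) (cong₂ _+_
  (trans (coeff-shift 1ℤ i _ (λ _ _ → refl) p e) (ℤP.*-identityˡ _))
  (trans (coeff-++ (map _ p) [] e) (trans (ℤP.+-identityʳ _)
    (trans (coeff-shift (ℤ.- 1ℤ) (suc i) _ (λ _ _ → refl) p e) (ℤP.-1*i≡-i _)))))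

IsDivDiff-coeff : ∀ i f g → IsDivDiff i f g → ∀ e →
  coeff g (lower i e) - coeff g (lower (suc i) e) ≡ coeff f e - coeff f (exch i e)
IsDivDiff-coeff i f g d e = trans (sym (coeff-xdiff i g e)) (trans (d e)
  (trans (coeff-++ f (neg (sPoly i f)) e)
    (cong (coeff f e +_) (trans (coeff-neg (sPoly i f) e) (cong ℤ.-_ (coeff-sPoly i f e))))))

coeff-support : ∀ p {e} → coeff p e ≢ 0ℤ → Any (λ t → proj₂ t ∼ e) p
coeff-support []            q = contradiction refl q
coeff-support ((c , a) ∷ p) {e} q with LP.≡-dec ℤ._≟_ (strip a) (strip e)
... | yes a∼e = here (same a∼e)
... | no  _   = there (coeff-support p q)

-- Degrees in the trailing variables

sumE : Mono → ℤ
sumE []      = 0ℤ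
sumE (x ∷ e) = x + sumE e

tail : ℕ → Mono → ℤ
tail k e = sumE (drop k e)

sumE-lower : ∀ k e → sumE (lower k e) ≡ sumE e - 1ℤ
sumE-lower zero    []      = refl
sumE-lower zero    (x ∷ e) = rearrange x (sumE e)
  where
  rearrange : ∀ (x s : ℤ) → x - 1ℤ + s ≡ x + s - 1ℤ
  rearrange = solve-∀
sumE-lower (suc k) []      = trans (ℤP.+-identityˡ _) (sumE-lower k [])
sumE-lower (suc k) (x ∷ e) = trans (cong (x +_) (sumE-lower k e)) (sym (ℤP.+-assoc x _ _))

tail-lower-< : ∀ {j k} → j < k → ∀ e → tail k (lower j e) ≡ tail k e
tail-lower-< {zero}  {suc zero}    _       []      = refl
tail-lower-< {zero}  {suc (suc k)} _       []      = refl
tail-lower-< {zero}  {suc k}       _       (x ∷ e) = refl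
tail-lower-< {suc j} {suc zero}    (s≤s ())
tail-lower-< {suc j} {suc (suc k)} (s≤s p) []      = tail-lower-< p []
tail-lower-< {suc j} {suc k}       (s≤s p) (x ∷ e) = tail-lower-< p e

tail-lower-≥ : ∀ {j k} → k ≤ j → ∀ e → tail k (lower j e) ≡ tail k e - 1ℤ
tail-lower-≥ {j}     {zero}  _       e       = sumE-lower j e
tail-lower-≥ {suc j} {suc zero}    (s≤s p) []      = tail-lower-≥ {j} {0} p []
tail-lower-≥ {suc j} {suc (suc k)} (s≤s p) []      = tail-lower-≥ p []
tail-lower-≥ {suc j} {suc k} (s≤s p) (x ∷ e) = tail-lower-≥ p e

sumE-zeros : ∀ e → (∀ k → get e k ≡ 0ℤ) → sumE e ≡ 0ℤ
sumE-zeros []      p = refl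
sumE-zeros (x ∷ e) p = cong₂ _+_ (p 0) (sumE-zeros e (p ∘ suc))

sumE-get : ∀ a b → (∀ k → get a k ≡ get b k) → sumE a ≡ sumE b
sumE-get []      b       p = sym (sumE-zeros b (sym ∘ p))
sumE-get (x ∷ a) []      p = sumE-zeros (x ∷ a) p
sumE-get (x ∷ a) (y ∷ b) p = cong₂ _+_ (p 0) (sumE-get a b (p ∘ suc))

get-drop : ∀ k e j → get (drop k e) j ≡ get e (k ℕ.+ j)
get-drop zero    e       j = refl
get-drop (suc k) []      j = refl
get-drop (suc k) (x ∷ e) j = get-drop k e j

tail-∼ : ∀ k {a b} → a ∼ b → tail k a ≡ tail k b
tail-∼ k {a} {b} p = sumE-get (drop k a) (drop k b) λ j →
  trans (get-drop k a j) (trans (∼⇒get p (k ℕ.+ j)) (sym (get-drop k b j)))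

sumE-mono : ∀ a b → (∀ k → get a k ℤ.≤ get b k) → sumE a ℤ.≤ sumE b
sumE-mono []      []      p = ℤP.≤-refl
sumE-mono []      (y ∷ b) p = ℤP.+-mono-≤ (p 0) (sumE-mono [] b (p ∘ suc))
sumE-mono (x ∷ a) []      p = ℤP.+-mono-≤ (p 0) (sumE-mono a [] (p ∘ suc))
sumE-mono (x ∷ a) (y ∷ b) p = ℤP.+-mono-≤ (p 0) (sumE-mono a b (p ∘ suc))

+-tight : ∀ {x y s t} → x ℤ.≤ y → s ℤ.≤ t → x + s ≡ y + t → x ≡ y × s ≡ t
+-tight {x} {y} {s} {t} p q r = x≡y , ℤGroup.∙-cancelˡ x s t (trans r (cong (_+ t) (sym x≡y)))
  where
  y+t≤x+t : y + t ℤ.≤ x + t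
  y+t≤x+t = subst (ℤ._≤ x + t) r (ℤP.+-monoʳ-≤ x q)
  x≡y : x ≡ y
  x≡y = ℤP.≤-antisym p (subst₂ ℤ._≤_ (cancel y t) (cancel x t) (ℤP.+-monoˡ-≤ (ℤ.- t) y+t≤x+t))
    where
    cancel : ∀ (a b : ℤ) → a + b - b ≡ a
    cancel = solve-∀

-- Isolates the staircase monomial in `staircase-𝔖`: termwise bounds reach the full sum only if each
-- is attained.
sumE-tight : ∀ a b → (∀ k → get a k ℤ.≤ get b k) → sumE a ≡ sumE b → ∀ k → get a k ≡ get b k
sumE-tight []      []      p q k = refl
sumE-tight []      (y ∷ b) p q k with +-tight {0ℤ} (p 0) (sumE-mono [] b (p ∘ suc)) q | k
... | h , t | zero   = h
... | h , t | suc k′ = sumE-tight [] b (p ∘ suc) t k′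
sumE-tight (x ∷ a) []      p q k with +-tight {x} {0ℤ} (p 0) (sumE-mono a [] (p ∘ suc)) q | k
... | h , t | zero   = h
... | h , t | suc k′ = sumE-tight a [] (p ∘ suc) t k′
sumE-tight (x ∷ a) (y ∷ b) p q k with +-tight (p 0) (sumE-mono a b (p ∘ suc)) q | k
... | h , t | zero   = h
... | h , t | suc k′ = sumE-tight a b (p ∘ suc) t k′

-- Inversions and supports

cnt : ℕ → List ℕ → ℕ
cnt x []      = 0
cnt x (y ∷ r) = (if y <ᵇ x then 1 else 0) ℕ.+ cnt x r

inv : List ℕ → ℕ
inv []      = 0
inv (x ∷ r) = cnt x r ℕ.+ inv r

<ᵇ-mono : ∀ z {x y} → x ≤ y → (z <ᵇ x) ≡ true → (z <ᵇ y) ≡ true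
<ᵇ-mono zero    (s≤s p) q = refl
<ᵇ-mono (suc z) (s≤s p) q = <ᵇ-mono z p q

<ᵇ⇒≤ : ∀ x y → (x <ᵇ y) ≡ true → x ≤ y
<ᵇ⇒≤ zero    (suc y) p = z≤n
<ᵇ⇒≤ (suc x) (suc y) p = s≤s (<ᵇ⇒≤ x y p)

≮ᵇ⇒≥ : ∀ x y → (x <ᵇ y) ≡ false → y ≤ x
≮ᵇ⇒≥ x       zero    p = z≤n
≮ᵇ⇒≥ (suc x) (suc y) p = s≤s (≮ᵇ⇒≥ x y p)

cnt-mono : ∀ {x y} → x ≤ y → ∀ r → cnt x r ≤ cnt y r
cnt-mono p [] = z≤n
cnt-mono {x} {y} p (z ∷ r) with z <ᵇ x in eq
... | false = ℕP.≤-trans (cnt-mono p r) (ℕP.m≤n+m _ (if z <ᵇ y then 1 else 0))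
... | true rewrite <ᵇ-mono z p eq = s≤s (cnt-mono p r)

cnt-swapL : ∀ x i r → cnt x (swapL i r) ≡ cnt x r
cnt-swapL x zero    []          = refl
cnt-swapL x zero    (y ∷ [])    = refl
cnt-swapL x zero    (y ∷ z ∷ r) = begin
  p ℕ.+ (q ℕ.+ cnt x r) ≡⟨ ℕP.+-assoc p q _ ⟨
  p ℕ.+ q ℕ.+ cnt x r   ≡⟨ cong (ℕ._+ cnt x r) (ℕP.+-comm p q) ⟩
  q ℕ.+ p ℕ.+ cnt x r   ≡⟨ ℕP.+-assoc q p _ ⟩
  q ℕ.+ (p ℕ.+ cnt x r) ∎
  where
  open ≡-Reasoning
  p = if z <ᵇ x then 1 else 0
  q = if y <ᵇ x then 1 else 0
cnt-swapL x (suc i) []      = refl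
cnt-swapL x (suc i) (y ∷ r) = cong ((if y <ᵇ x then 1 else 0) ℕ.+_) (cnt-swapL x i r)

inv-swapL : ∀ i w → desc i w ≡ true → inv w ≡ suc (inv (swapL i w))
inv-swapL zero (x ∷ y ∷ r) p rewrite p | <ᵇ-asym y x p =
  cong suc (begin
    cnt x r ℕ.+ (cnt y r ℕ.+ inv r) ≡⟨ ℕP.+-assoc (cnt x r) _ _ ⟨
    cnt x r ℕ.+ cnt y r ℕ.+ inv r   ≡⟨ cong (ℕ._+ inv r) (ℕP.+-comm (cnt x r) (cnt y r)) ⟩
    cnt y r ℕ.+ cnt x r ℕ.+ inv r   ≡⟨ ℕP.+-assoc (cnt y r) _ _ ⟩
    cnt y r ℕ.+ (cnt x r ℕ.+ inv r) ∎)
  where open ≡-Reasoning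
inv-swapL (suc i) (x ∷ r) p =
  trans (cong₂ ℕ._+_ (sym (cnt-swapL x i r)) (inv-swapL i r p)) (ℕP.+-suc _ _)

inv-drop-swapL : ∀ {k i} → k ≤ i → ∀ w → desc i w ≡ true →
  inv (drop k w) ≡ suc (inv (drop k (swapL i w)))
inv-drop-swapL {zero}  {i}     _       w       p = inv-swapL i w p
inv-drop-swapL {suc k} {suc i} (s≤s q) (x ∷ r) p = inv-drop-swapL q r p

-- The swap puts the larger of the two entries in position i+1, and a larger entry exceeds at least
-- as many of those that follow.
inv-drop-swapL-next : ∀ i w → desc i w ≡ true →
  inv (drop (suc i) w) ≤ inv (drop (suc i) (swapL i w))
inv-drop-swapL-next zero    (x ∷ y ∷ r) p = ℕP.+-monoˡ-≤ (inv r) (cnt-mono (<ᵇ⇒≤ y x p) r)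
inv-drop-swapL-next (suc i) (x ∷ r)     p = inv-drop-swapL-next i r p

-- Supports along the product

Supp : (List ℕ → Mono → Set) → Coeffs → Set
Supp P φ = ∀ w e → φ w e ≢ 0ℤ → P w e

-- A nonzero coefficient of φ (1 + x_k u_i) needs one in φ (`stay`) or in φ x_k u_i (`move`).
-- Passing from `P` to `P′` allows bounds that grow with each factor, as in `row-bound`.
Supp-H : ∀ {P P′ : List ℕ → Mono → Set} i k {φ} → (∀ w e → P w e → P′ w e) →
  (∀ w e → desc i w ≡ true → P (swapL i w) (lower k e) → P′ w e) →
  Supp P φ → Supp P′ (H i k φ)
Supp-H i k {φ} stay move s w e nz with φ w e ℤ.≟ 0ℤ
... | no ≢0 = stay w e (s w e ≢0)
... | yes ≡0 with desc i w in d
...   | true  = move w e d (s _ _ (λ z → nz (cong₂ _+_ ≡0 z)))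
...   | false = contradiction (cong₂ _+_ ≡0 refl) nz

Supp-A : ∀ {P : List ℕ → Mono → Set} j n k {φ} →
  (∀ {i} → j ≤ i → ∀ w e → desc i w ≡ true → P (swapL i w) (lower k e) → P w e) →
  Supp P φ → Supp P (A j n k φ)
Supp-A         j zero    k move s = s
Supp-A {P = P} j (suc n) k move s = Supp-H {P} {P} j k (λ _ _ p → p) (move ℕP.≤-refl)
  (Supp-A {P} (suc j) n k (λ q → move (ℕP.<⇒≤ q)) s)

-- Every factor 1 + x_k u_i of the rows has k ≤ i, and `move` may rely on this.
Supp-S : ∀ {P : List ℕ → Mono → Set} j n {φ} →
  (∀ {k i} → j ≤ k → k ≤ i → ∀ w e → desc i w ≡ true → P (swapL i w) (lower k e) → P w e) →
  Supp P φ → Supp P (S j n φ)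
Supp-S         j zero    move s = s
Supp-S {P = P} j (suc n) move s = Supp-S {P} (suc j) n (λ q → move (ℕP.<⇒≤ q))
  (Supp-A {P} j (suc n) j (move ℕP.≤-refl) s)

-- Schubert coefficients and bounds on their exponents

one : Poly
one = (1ℤ , []) ∷ []

-- Stands for the identity permutation; every list without inversions counts as such.
δ : Coeffs
δ w e = if inv w ≡ᵇ 0 then coeff one e else 0ℤ

-- The coefficients of the Schubert polynomials of S_{N+1}.
𝔖 : ℕ → Coeffs
𝔖 N = S 0 N δ

δ-supp : Supp (λ w e → inv w ≡ 0 × (∀ k → get e k ≡ 0ℤ)) δ
δ-supp w e nz with inv w
... | suc _ = contradiction refl nz
... | zero with coeff-support one {e} nz
...   | here q = refl , λ k → sym (∼⇒get q k)

Sym-δ : ∀ i → Sym i δ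
Sym-δ i w e with inv w
... | suc _ = refl
... | zero  = trans (sym (coeff-sPoly i one e)) (cong (λ a → coeff ((1ℤ , a) ∷ []) e) (swapE-[] i))
  where
  swapE-[] : ∀ i → swapE i [] ≡ []
  swapE-[] zero    = refl
  swapE-[] (suc i) = refl

Div-𝔖 : ∀ {i N} → i < N → Div i (𝔖 N)
Div-𝔖 {i} {N} p = subst (λ j → Div j (𝔖 N)) (ℕP.+-identityʳ i)
  (Div-rows 0 i N δ (Sym-δ (i ℕ.+ 0)) p)

-1-injective : ∀ {x y} → x - 1ℤ ≡ y - 1ℤ → x ≡ y
-1-injective {x} {y} = ℤGroup.∙-cancelʳ (ℤ.- 1ℤ) x y

𝔖-degree : ∀ N → Supp (λ w e → sumE e ≡ pos (inv w)) (𝔖 N)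
𝔖-degree N = Supp-S 0 N
  (λ {k} {i} _ _ w e d q → -1-injective
    (trans (sym (sumE-lower k e)) (trans q (cong (λ t → pos t - 1ℤ) (sym (inv-swapL i w d))))))
  (λ w e nz → let (i0 , z) = δ-supp w e nz in trans (sumE-zeros e z) (cong pos (sym i0)))

lower-≤ : ∀ k e j → get (lower k e) j ℤ.≤ get e j
lower-≤ k e j with k ℕ.≟ j
... | yes refl = subst (ℤ._≤ get e j) (sym (get-lower-≡ k e)) (ℤP.i-j≤i (get e j) 1ℤ)
... | no k≢j   = ℤP.≤-reflexive (get-lower-≢ k≢j e)

𝔖-nonneg : ∀ N j → Supp (λ _ e → 0ℤ ℤ.≤ get e j) (𝔖 N)
𝔖-nonneg N j = Supp-S 0 N (λ {k} _ _ w e _ q → ℤP.≤-trans q (lower-≤ k e j))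
  (λ w e nz → ℤP.≤-reflexive (sym (proj₂ (δ-supp w e nz) j)))

-- The rows before x_k leave the degree in x_k, x_{k+1}, ... at 0. Each later x_j u_i has k ≤ j ≤ i,
-- so it raises this degree by one and adds an inversion among the positions ≥ k.
tail-bound : ∀ k i n {φ} → i ≤ k → Supp (λ _ e → tail k e ≡ 0ℤ) φ →
  Supp (λ w e → tail k e ℤ.≤ pos (inv (drop k w))) (S i n φ)
tail-bound k i zero    p s w e nz = subst (ℤ._≤ _) (sym (s w e nz)) (ℤ.+≤+ z≤n)
tail-bound k i (suc n) p s with ℕP.m≤n⇒m<n∨m≡n p
... | inj₁ i<k = tail-bound k (suc i) n i<k
  (Supp-A i (suc n) i (λ _ w e _ q → trans (sym (tail-lower-< i<k e)) q) s)
... | inj₂ refl = Supp-S {λ w e → tail k e ℤ.≤ pos (inv (drop k w))} k (suc n)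
  (λ {j} {i} k≤j j≤i w e d q → move w e (subst (ℤ._≤ _) (tail-lower-≥ k≤j e) q)
    (inv-drop-swapL (ℕP.≤-trans k≤j j≤i) w d))
  (λ w e nz → subst (ℤ._≤ _) (sym (s w e nz)) (ℤ.+≤+ z≤n))
  where
  move : ∀ w e {m} → tail k e - 1ℤ ℤ.≤ pos m → inv (drop k w) ≡ suc m →
    tail k e ℤ.≤ pos (inv (drop k w))
  move w e {m} q r = subst₂ ℤ._≤_ (cancel (tail k e)) (cong pos (trans (ℕP.+-comm m 1) (sym r)))
    (ℤP.+-monoˡ-≤ 1ℤ q)
    where
    cancel : ∀ (t : ℤ) → t - 1ℤ + 1ℤ ≡ t
    cancel = solve-∀

get≡0⇒tail≡0 : ∀ k e → (∀ j → get e j ≡ 0ℤ) → tail k e ≡ 0ℤ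
get≡0⇒tail≡0 k e z = sumE-zeros (drop k e) (λ j → trans (get-drop k e j) (z _))

𝔖-tail : ∀ N k → Supp (λ w e → tail k e ℤ.≤ pos (inv (drop k w))) (𝔖 N)
𝔖-tail N k = tail-bound k 0 N z≤n (λ w e nz → get≡0⇒tail≡0 k e (proj₂ (δ-supp w e nz)))

row-bound : ∀ i n k {b φ} → Supp (λ _ e → get e k ℤ.≤ pos b) φ →
  Supp (λ _ e → get e k ℤ.≤ pos (n ℕ.+ b)) (A i n k φ)
row-bound i zero    k s = s
row-bound i (suc n) k {b} s = Supp-H
  {λ _ e → get e k ℤ.≤ pos (n ℕ.+ b)} {λ _ e → get e k ℤ.≤ pos (suc n ℕ.+ b)} i k
  (λ _ _ q → ℤP.≤-trans q (ℤ.+≤+ (ℕP.n≤1+n _)))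
  (λ _ e _ q → subst₂ ℤ._≤_ (cancel (get e k)) refl
    (ℤP.+-monoʳ-≤ 1ℤ (subst (ℤ._≤ _) (get-lower-≡ k e) q)))
  (row-bound (suc i) n k s)
  where
  cancel : ∀ (t : ℤ) → 1ℤ + (t - 1ℤ) ≡ t
  cancel = solve-∀

-- x_k occurs only in its own row, which has `i ℕ.+ n ∸ k` factors.
exponent-bound : ∀ k i n {φ} → i ≤ k → Supp (λ _ e → get e k ℤ.≤ 0ℤ) φ →
  Supp (λ _ e → get e k ℤ.≤ pos (i ℕ.+ n ∸ k)) (S i n φ)
exponent-bound k i zero    p s w e nz = ℤP.≤-trans (s w e nz) (ℤ.+≤+ z≤n)
exponent-bound k i (suc n) {φ} p s with ℕP.m≤n⇒m<n∨m≡n p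
... | inj₁ i<k = subst (λ m → Supp (λ _ e → get e k ℤ.≤ pos (m ∸ k)) (S i (suc n) φ))
  (sym (ℕP.+-suc i n))
  (exponent-bound k (suc i) n i<k (Supp-A i (suc n) i
    (λ _ w e _ q → subst (ℤ._≤ 0ℤ) (get-lower-≢ (ℕP.<⇒≢ i<k) e) q) s))
... | inj₂ refl = subst (λ b → Supp (λ _ e → get e k ℤ.≤ pos b) (S k (suc n) φ))
  (trans (ℕP.+-identityʳ (suc n)) (sym (ℕP.m+n∸m≡n k (suc n))))
  (Supp-S {λ _ e → get e k ℤ.≤ pos (suc n ℕ.+ 0)} (suc k) n
    (λ k<j _ w e _ q → subst (ℤ._≤ _) (get-lower-≢ (ℕP.<⇒≢ k<j ∘ sym) e) q)
    (row-bound k (suc n) k s))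

𝔖-exponent : ∀ N k → Supp (λ _ e → get e k ℤ.≤ pos (N ∸ k)) (𝔖 N)
𝔖-exponent N k = exponent-bound k 0 N z≤n
  (λ w e nz → ℤP.≤-reflexive (proj₂ (δ-supp w e nz) k))

Resp : Coeffs → Set
Resp φ = ∀ w {a b} → a ∼ b → φ w a ≡ φ w b

Resp-A : ∀ j n k {φ} → Resp φ → Resp (A j n k φ)
Resp-A j zero    k r = r
Resp-A j (suc n) k {φ} r w {a} {b} q = cong₂ _+_ (r′ w q) rest
  where
  r′ = Resp-A (suc j) n k r
  rest : R j (A (suc j) n k φ) w (lower k a) ≡ R j (A (suc j) n k φ) w (lower k b)
  rest with desc j w
  ... | true  = r′ (swapL j w) (lower-∼ k q)
  ... | false = refl

Resp-S : ∀ j n {φ} → Resp φ → Resp (S j n φ)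
Resp-S j zero    r = r
Resp-S j (suc n) {φ} r = Resp-S (suc j) n (Resp-A j (suc n) j {φ} r)

𝔖-resp : ∀ N → Resp (𝔖 N)
𝔖-resp N = Resp-S 0 N λ w q → cong (λ t → if inv w ≡ᵇ 0 then t else 0ℤ) (coeff-∼ one q)

-- Leading monomials

-- The Lehmer code as an exponent vector.
code : List ℕ → Mono
code []      = []
code (x ∷ r) = pos (cnt x r) ∷ code r

-- The code attains all the bounds of `𝔖-tail` at once, so it leads as soon as it occurs.
tail-code : ∀ k w → tail k (code w) ≡ pos (inv (drop k w))
tail-code zero    []      = refl
tail-code zero    (x ∷ r) = cong (pos (cnt x r) +_) (tail-code zero r)
tail-code (suc k) []      = refl
tail-code (suc k) (x ∷ r) = tail-code k r

-- Swapping a descent exchanges the two code entries, except that the larger entry no longer counts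
-- the smaller one.
code-swapL : ∀ i w → desc i w ≡ true → lower (suc i) (exch i (code w)) ≡ code (swapL i w)
code-swapL zero    (x ∷ y ∷ r) p rewrite p | <ᵇ-asym y x p = refl
code-swapL (suc i) (x ∷ r)     p =
  cong₂ _∷_ (cong pos (sym (cnt-swapL x i r))) (code-swapL i r p)

desc-length : ∀ i w → desc i w ≡ true → suc i < length w
desc-length zero    (x ∷ y ∷ r) p = s≤s (s≤s z≤n)
desc-length (suc i) (x ∷ r)     p = s≤s (desc-length i r p)

inv≢0⇒desc : ∀ w → inv w ≢ 0 → ∃ λ i → desc i w ≡ true
inv≢0⇒desc []      p = contradiction refl p
inv≢0⇒desc (x ∷ r) p with inv r ℕ.≟ 0
... | no q  = let (i , d) = inv≢0⇒desc r q in suc i , d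
... | yes q = 0 , first r q (λ z → p (cong₂ ℕ._+_ z q))
  where
  first : ∀ r → inv r ≡ 0 → cnt x r ≢ 0 → desc 0 (x ∷ r) ≡ true
  first []      q c = contradiction refl c
  first (y ∷ r) q c with y <ᵇ x in eq
  ... | true  = refl
  ... | false = contradiction (ℕP.n≤0⇒n≡0 (ℕP.≤-trans (cnt-mono (≮ᵇ⇒≥ y x eq) r)
    (ℕP.≤-reflexive (ℕP.m+n≡0⇒m≡0 (cnt y r) q)))) c

A-sorted : ∀ j n k φ w e → inv w ≡ 0 → A j n k φ w e ≡ φ w e
A-sorted j zero    k φ w e z = refl
A-sorted j (suc n) k φ w e z with desc j w in d
... | false = trans (ℤP.+-identityʳ _) (A-sorted (suc j) n k φ w e z)
... | true  = contradiction (trans (sym (inv-swapL j w d)) z) λ ()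

S-sorted : ∀ j n φ w e → inv w ≡ 0 → S j n φ w e ≡ φ w e
S-sorted j zero    φ w e z = refl
S-sorted j (suc n) φ w e z =
  trans (S-sorted (suc j) n (A j (suc n) j φ) w e z) (A-sorted j (suc n) j φ w e z)

get-code-sorted : ∀ w → inv w ≡ 0 → ∀ k → get (code w) k ≡ 0ℤ
get-code-sorted []      z k       = refl
get-code-sorted (x ∷ r) z zero    = cong pos (ℕP.m+n≡0⇒m≡0 (cnt x r) z)
get-code-sorted (x ∷ r) z (suc k) = get-code-sorted r (ℕP.m+n≡0⇒n≡0 (cnt x r) z) k

-- For a descent i of w, only the coefficients at code w and at code (w s_i)
-- survive in the divided difference relation at e = s_i (code w): the other
-- two violate the bound on the degree in the variables beyond x_i.
𝔖-code : ∀ N t w → inv w ≡ t → length w ≤ suc N → 𝔖 N w (code w) ≡ 1ℤ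
𝔖-code N zero w z l = begin
  𝔖 N w (code w)                                   ≡⟨ S-sorted 0 N δ w (code w) z ⟩
  δ w (code w)                                     ≡⟨ cong (λ t → if t ≡ᵇ 0 then coeff one (code w) else 0ℤ) z ⟩
  coeff one (code w)                               ≡⟨ coeff-∼ one (∼-zeros (code w) (get-code-sorted w z)) ⟩
  1ℤ ∎
  where open ≡-Reasoning
𝔖-code N (suc t) w z l = begin
  𝔖 N w (code w)  ≡⟨ 𝔖-resp N w (exch-exch-∼ i (code w)) ⟨
  𝔖 N w (exch i e)
    ≡⟨ isolate (subst₂ _≡_ (cong (_- 𝔖 N w (exch i e)) 𝔖e≡0)
         (cong₂ _-_ (trans (R-desc (lower i e)) 𝔖′≡0) (R-desc (lower (suc i) e)))
         (Div-𝔖 {i} {N} (ℕP.≤-pred (ℕP.≤-trans (desc-length i w d) l)) w e)) ⟩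
  𝔖 N w′ (lower (suc i) e)  ≡⟨ cong (𝔖 N w′) (code-swapL i w d) ⟩
  𝔖 N w′ (code w′)
    ≡⟨ 𝔖-code N t w′ (ℕP.suc-injective (trans (sym (inv-swapL i w d)) z))
         (ℕP.≤-trans (ℕP.≤-reflexive (length-swapL i w)) l) ⟩
  1ℤ ∎
  where
  open ≡-Reasoning
  found = inv≢0⇒desc w λ z′ → contradiction (trans (sym z′) z) λ ()
  i = proj₁ found
  d = proj₂ found
  w′ = swapL i w
  e = exch i (code w)
  length-swapL : ∀ i w → length (swapL i w) ≡ length w
  length-swapL zero    []          = refl
  length-swapL zero    (x ∷ [])    = refl
  length-swapL zero    (x ∷ y ∷ w) = refl
  length-swapL (suc i) []          = refl
  length-swapL (suc i) (x ∷ w)     = cong suc (length-swapL i w)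
  R-desc : ∀ e → R i (𝔖 N) w e ≡ 𝔖 N w′ e
  R-desc e = cong (λ t → if t then 𝔖 N w′ e else 0ℤ) d
  -- By `code-swapL`, `e` is the code of `w′` with exponent i+1 raised by one. Its degree beyond x_i
  -- thus exceeds the bound for `w′`, and by `inv-drop-swapL-next` also that for `w`.
  tail-e : tail (suc i) e ≡ pos (suc (inv (drop (suc i) w′)))
  tail-e = begin
    tail (suc i) e                        ≡⟨ cancel (tail (suc i) e) ⟩
    1ℤ + (tail (suc i) e - 1ℤ)            ≡⟨ cong (1ℤ +_) (tail-lower-≥ {suc i} ℕP.≤-refl e) ⟨
    1ℤ + tail (suc i) (lower (suc i) e)   ≡⟨ cong (λ t → 1ℤ + tail (suc i) t) (code-swapL i w d) ⟩
    1ℤ + tail (suc i) (code w′)           ≡⟨ cong (1ℤ +_) (tail-code (suc i) w′) ⟩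
    1ℤ + pos (inv (drop (suc i) w′)) ∎
    where
    cancel : ∀ (t : ℤ) → t ≡ 1ℤ + (t - 1ℤ)
    cancel = solve-∀
  vanish : ∀ v e′ → tail (suc i) e′ ≡ tail (suc i) e →
    inv (drop (suc i) v) ≤ inv (drop (suc i) w′) → 𝔖 N v e′ ≡ 0ℤ
  vanish v e′ p q = decidable-stable (𝔖 N v e′ ℤ.≟ 0ℤ) λ nz →
    ℕP.<⇒≱ (s≤s q) (ℤP.drop‿+≤+ (subst (ℤ._≤ _) (trans p tail-e) (𝔖-tail N (suc i) v e′ nz)))
  𝔖e≡0 : 𝔖 N w e ≡ 0ℤ
  𝔖e≡0 = vanish w e refl (inv-drop-swapL-next i w d)
  𝔖′≡0 : 𝔖 N w′ (lower i e) ≡ 0ℤ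
  𝔖′≡0 = vanish w′ (lower i e) (tail-lower-< ℕP.≤-refl e) ℕP.≤-refl
  isolate : ∀ {x y} → 0ℤ - x ≡ 0ℤ - y → x ≡ y
  isolate {x} {y} p = trans (flip x) (trans (cong (0ℤ -_) p) (sym (flip y)))
    where
    flip : ∀ (x : ℤ) → x ≡ 0ℤ - (0ℤ - x)
    flip = solve-∀

-- Identification with the recursive definition

support-bound : ∀ p k → ∃ λ B → ∀ e → coeff p e ≢ 0ℤ → B ℤ.≤ get e k
support-bound p k = proj₁ (bound p) , λ e nz → proj₂ (bound p) (coeff-support p nz)
  where
  bound : ∀ p → ∃ λ B → ∀ {e} → Any (λ t → proj₂ t ∼ e) p → B ℤ.≤ get e k
  bound []            = 0ℤ , λ ()
  bound ((c , a) ∷ p) = get a k ℤ.⊓ proj₁ (bound p) , λ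
    { (here q)  → ℤP.≤-trans (ℤP.i⊓j≤i _ _) (ℤP.≤-reflexive (∼⇒get q k))
    ; (there q) → ℤP.≤-trans (ℤP.i⊓j≤j (get a k) _) (proj₂ (bound p) q) }

-- x_i - x_{i+1} is not a zero divisor: a Δ it annihilates is constant along the
-- direction ε_i - ε_{i+1}, which leaves the support.
xdiff-cancel : ∀ i (Δ : Mono → ℤ) B → (∀ {a b} → a ∼ b → Δ a ≡ Δ b) →
  (∀ e → Δ e ≢ 0ℤ → B ℤ.≤ get e (suc i)) →
  (∀ e → Δ (lower i e) ≡ Δ (lower (suc i) e)) → ∀ e → Δ e ≡ 0ℤ
xdiff-cancel i Δ B resp bound shift e = decidable-stable (Δ e ℤ.≟ 0ℤ) λ nz →
  -- The number of slides is one more than the distance from the exponent to `B`.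
  ℤP.≤⇒≯ (push (suc ℤ.∣ get e (suc i) - B ∣) e nz) (far (get e (suc i)))
  where
  push : ∀ t e → Δ e ≢ 0ℤ → B + pos t ℤ.≤ get e (suc i)
  push zero    e nz = subst (ℤ._≤ _) (sym (ℤP.+-identityʳ B)) (bound e nz)
  -- Slides `e` to e + ε_i - ε_{i+1}: Δ keeps its value, and the exponent of x_{i+1} drops by one.
  push (suc t) e nz = subst₂ ℤ._≤_ (assoc B (pos t)) back
    (ℤP.+-monoˡ-≤ 1ℤ (push t (lower (suc i) e⁺) (nz ∘ trans slide)))
    where
    e⁺ = addE (unitE i) e
    slide : Δ e ≡ Δ (lower (suc i) e⁺)
    slide = trans (sym (resp (lower-addE-unitE i e))) (shift e⁺)
    assoc : ∀ (b t : ℤ) → b + t + 1ℤ ≡ b + (1ℤ + t)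
    assoc = solve-∀
    cancel : ∀ (g : ℤ) → 0ℤ + g - 1ℤ + 1ℤ ≡ g
    cancel = solve-∀
    back : get (lower (suc i) e⁺) (suc i) + 1ℤ ≡ get e (suc i)
    back = trans (cong (_+ 1ℤ) (trans (get-lower-≡ (suc i) e⁺)
      (cong (_- 1ℤ) (trans (get-addE (unitE i) e (suc i))
        (cong (_+ get e (suc i)) (get-unitE-≢ (ℕP.<⇒≢ (ℕP.n<1+n i))))))))
      (cancel (get e (suc i)))
  i≤∣i∣ : ∀ j → j ℤ.≤ pos ℤ.∣ j ∣
  i≤∣i∣ (pos n)      = ℤP.≤-refl
  i≤∣i∣ (ℤ.-[1+ n ]) = ℤ.-≤+
  far : ∀ g → g ℤ.< B + pos (suc ℤ.∣ g - B ∣)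
  far g = ℤP.≤-<-trans (subst (ℤ._≤ B + pos ℤ.∣ g - B ∣) (cancel B g) (ℤP.+-monoʳ-≤ B (i≤∣i∣ (g - B))))
    (ℤP.+-monoʳ-< B (ℤ.+<+ (ℕP.n<1+n _)))
    where
    cancel : ∀ (b g : ℤ) → b + (g - b) ≡ g
    cancel = solve-∀

at-length : ∀ w i {a} → at w i ≡ just a → i < length w
at-length (x ∷ w) zero    p = s≤s z≤n
at-length (x ∷ w) (suc i) p = s≤s (at-length w i p)

<⇒<ᵇ : ∀ {x y} → x < y → (x <ᵇ y) ≡ true
<⇒<ᵇ {zero}  (s≤s p) = refl
<⇒<ᵇ {suc x} (s≤s p) = <⇒<ᵇ p

desc-swapL : ∀ w i {a b} → at w i ≡ just a → at w (suc i) ≡ just b → a < b →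
  desc i (swapL i w) ≡ true × swapL i (swapL i w) ≡ w × length (swapL i w) ≡ length w
desc-swapL (x ∷ y ∷ w) zero    refl refl a<b = <⇒<ᵇ a<b , refl , refl
desc-swapL (x ∷ w)     (suc i) p    q    a<b =
  let (d , s , l) = desc-swapL w i p q a<b in d , cong (x ∷_) s , cong suc l

cnt-w0 : ∀ x m → m < x → cnt x (w0 m) ≡ m
cnt-w0 x zero    p = refl
cnt-w0 x (suc m) p rewrite <⇒<ᵇ p = cong suc (cnt-w0 x m (ℕP.<⇒≤ p))

code-w0 : ∀ m → code (w0 m) ≡ staircaseE m
code-w0 zero    = refl
code-w0 (suc m) = cong₂ _∷_ (cong pos (cnt-w0 (suc m) m ℕP.≤-refl)) (code-w0 m)

length-w0 : ∀ m → length (w0 m) ≡ m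
length-w0 zero    = refl
length-w0 (suc m) = cong suc (length-w0 m)

get-staircaseE : ∀ m k → get (staircaseE m) k ≡ pos (m ∸ 1 ∸ k)
get-staircaseE zero    zero    = refl
get-staircaseE zero    (suc k) = refl
get-staircaseE (suc m) zero    = refl
get-staircaseE (suc m) (suc k) = trans (get-staircaseE m k) (cong pos (ℕP.∸-+-assoc m 1 k))

n≤1+n∸1 : ∀ n → n ≤ suc (n ∸ 1)
n≤1+n∸1 zero    = z≤n
n≤1+n∸1 (suc n) = ℕP.≤-refl

-- The exponent bounds are those of the staircase and the degrees agree, so only the staircase
-- monomial can occur; it is the code of `w0 m`, with coefficient 1.
staircase-𝔖 : ∀ m e → coeff (staircase m) e ≡ 𝔖 (m ∸ 1) (w0 m) e
staircase-𝔖 m e with LP.≡-dec ℤ._≟_ (strip (staircaseE m)) (strip e)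
... | yes p = sym (trans (sym (𝔖-resp (m ∸ 1) (w0 m)
    (subst (_∼ e) (sym (code-w0 m)) (same p))))
  (𝔖-code (m ∸ 1) _ (w0 m) refl (subst (_≤ suc (m ∸ 1)) (sym (length-w0 m)) (n≤1+n∸1 m))))
... | no ¬p = sym (decidable-stable (𝔖 (m ∸ 1) (w0 m) e ℤ.≟ 0ℤ) λ nz → ¬p (strips
  (∼-sym {e} {staircaseE m} (get⇒∼ (sumE-tight e (staircaseE m)
    (λ k → subst (get e k ℤ.≤_) (sym (get-staircaseE m k)) (𝔖-exponent (m ∸ 1) k (w0 m) e nz))
    (trans (𝔖-degree (m ∸ 1) (w0 m) e nz)
      (trans (sym (tail-code 0 (w0 m))) (cong sumE (code-w0 m)))))))))

-- Induction on the derivation; swaps keep the length, hence `N`. In a step, `P` and 𝔖 satisfy the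
-- same divided-difference equation over `Q`, so x_i - x_{i+1} annihilates their difference.
Schubert-𝔖 : ∀ {u P} → Schubert u P → ∀ e → coeff P e ≡ 𝔖 (length u ∸ 1) u e
Schubert-𝔖 (top m) e =
  trans (staircase-𝔖 m e) (cong (λ l → 𝔖 (l ∸ 1) (w0 m) e) (sym (length-w0 m)))
Schubert-𝔖 (step w i a b P Q pa pb a<b sch dd) e =
  ℤP.i-j≡0⇒i≡j _ _ (xdiff-cancel i Δ (B ℤ.⊓ 0ℤ)
    (λ q → cong₂ _-_ (coeff-∼ P q) (𝔖-resp N w q)) bound shift e)
  where
  open ≡-Reasoning
  N = length w ∸ 1
  Δ : Mono → ℤ
  Δ e = coeff P e - 𝔖 N w e
  w′ = swapL i w
  sw = desc-swapL w i pa pb a<b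
  B = proj₁ (support-bound P (suc i))
  -- `P` might have negative exponents, bounded below by `B`; those of 𝔖 are at least 0.
  bound : ∀ e → Δ e ≢ 0ℤ → B ℤ.⊓ 0ℤ ℤ.≤ get e (suc i)
  bound e nz with coeff P e ℤ.≟ 0ℤ | 𝔖 N w e ℤ.≟ 0ℤ
  ... | no p  | _     = ℤP.≤-trans (ℤP.i⊓j≤i B 0ℤ) (proj₂ (support-bound P (suc i)) e p)
  ... | yes _ | no q  = ℤP.≤-trans (ℤP.i⊓j≤j B 0ℤ) (𝔖-nonneg N (suc i) w e q)
  ... | yes p | yes q = contradiction (cong₂ _-_ p q) nz
  i<N : i < N
  i<N = ℕP.≤-pred (ℕP.≤-trans (at-length w (suc i) pb) (n≤1+n∸1 (length w)))
  R-w′ : ∀ e → R i (𝔖 N) w′ e ≡ 𝔖 N w e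
  R-w′ e = trans (cong (λ t → if t then 𝔖 N (swapL i w′) e else 0ℤ) (proj₁ sw))
                 (cong (λ v → 𝔖 N v e) (proj₁ (proj₂ sw)))
  coeff-Q : ∀ e → coeff Q e ≡ 𝔖 N w′ e
  coeff-Q e = trans (Schubert-𝔖 sch e) (cong (λ l → 𝔖 (l ∸ 1) w′ e) (proj₂ (proj₂ sw)))
  shift : ∀ e → Δ (lower i e) ≡ Δ (lower (suc i) e)
  shift e = regroup {coeff P (lower i e)} {_} {𝔖 N w (lower i e)} (begin
    coeff P (lower i e) - coeff P (lower (suc i) e)
      ≡⟨ IsDivDiff-coeff i Q P dd e ⟩
    coeff Q e - coeff Q (exch i e)
      ≡⟨ cong₂ _-_ (coeff-Q e) (coeff-Q (exch i e)) ⟩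
    𝔖 N w′ e - 𝔖 N w′ (exch i e)
      ≡⟨ Div-𝔖 i<N w′ e ⟩
    R i (𝔖 N) w′ (lower i e) - R i (𝔖 N) w′ (lower (suc i) e)
      ≡⟨ cong₂ _-_ (R-w′ (lower i e)) (R-w′ (lower (suc i) e)) ⟩
    𝔖 N w (lower i e) - 𝔖 N w (lower (suc i) e) ∎)
    where
    regroup : ∀ {p q r s} → p - q ≡ r - s → p - r ≡ q - s
    regroup {p} {q} {r} {s} h =
      trans (split p q r) (trans (cong (λ t → t + q - r) h) (merge q r s))
      where
      split : ∀ (p q r : ℤ) → p - r ≡ p - q + q - r
      split = solve-∀
      merge : ∀ (q r s : ℤ) → r - s + q - r ≡ q - s
      merge = solve-∀

-- The reciprocal of 𝔖_1432

coeff-nonneg : ∀ {p} → All (λ t → proj₁ t ≡ 1ℤ) p → ∀ e → 0ℤ ℤ.≤ coeff p e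
coeff-nonneg [] e = ℤP.≤-refl
coeff-nonneg {(c , a) ∷ p} (refl ∷ ones) e with LP.≡-dec ℤ._≟_ (strip a) (strip e)
... | yes _ = ℤP.+-mono-≤ {0ℤ} {1ℤ} (ℤ.+≤+ z≤n) (coeff-nonneg ones e)
... | no  _ = coeff-nonneg ones e

-- With all coefficients 1 nothing cancels, even where monomials coincide.
coeff-positive : ∀ {p} → All (λ t → proj₁ t ≡ 1ℤ) p → ∀ {e} → Any (λ t → proj₂ t ∼ e) p →
  0ℤ ℤ.< coeff p e
coeff-positive {(c , a) ∷ p} (refl ∷ ones) {e} q with LP.≡-dec ℤ._≟_ (strip a) (strip e)
... | yes _ = ℤP.<-≤-trans (ℤ.+<+ (s≤s z≤n)) (ℤP.+-monoʳ-≤ 1ℤ (coeff-nonneg ones e))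
coeff-positive (refl ∷ ones) (here q)  | no ¬q = contradiction (strips q) ¬q
coeff-positive (refl ∷ ones) (there q) | no _  = coeff-positive ones q

minus-injective : ∀ (x : ℤ) p q → x - pos p ≡ x - pos q → p ≡ q
minus-injective x p q h = ℤP.+-injective (ℤP.neg-injective (ℤGroup.∙-cancelˡ x _ _ h))

minus-antitone : ∀ (x s : ℤ) p q → x - pos p + s ℤ.≤ x - pos q + s → q ≤ p
minus-antitone x s p q h = ℤP.drop‿+≤+ (subst₂ ℤ._≤_
  (cancelˡ x s (pos p) (pos q)) (cancelʳ x s (pos p) (pos q))
  (ℤP.+-monoˡ-≤ (pos p + pos q - x - s) h))
  where
  cancelˡ : ∀ (x s p q : ℤ) → x - p + s + (p + q - x - s) ≡ q
  cancelˡ = solve-∀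
  cancelʳ : ∀ (x s p q : ℤ) → x - q + s + (p + q - x - s) ≡ p
  cancelʳ = solve-∀

module Reciprocal (a b c : ℤ) (ρ : Mono) where

  -- With a, b, c standing for μ₁, μ₂, μ₃, this is the reciprocal image of x₁^p x₂^q x₃^r.
  mono : ℕ → ℕ → ℕ → Mono
  mono p q r = (a - pos p) ∷ (b - pos q) ∷ (c - pos r) ∷ ρ

  F : Poly
  F = (1ℤ , mono 2 1 0) ∷ (1ℤ , mono 2 0 1) ∷ (1ℤ , mono 1 2 0)
    ∷ (1ℤ , mono 1 1 1) ∷ (1ℤ , mono 0 2 1) ∷ []

  F-positive : ∀ {e} → Any (λ t → proj₂ t ∼ e) F → coeff F e ≢ 0ℤ
  F-positive q z = ℤP.<-irrefl (sym z) (coeff-positive (refl ∷ refl ∷ refl ∷ refl ∷ refl ∷ []) q)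

  module Support N u (F≡𝔖 : ∀ e → coeff F e ≡ 𝔖 N u e) (u-length : length u ≤ suc N) where

    support : ∀ {e} → 𝔖 N u e ≢ 0ℤ → Any (λ t → proj₂ t ∼ e) F
    support nz = coeff-support F (nz ∘ trans (sym (F≡𝔖 _)))

    present : ∀ {e} → Any (λ t → proj₂ t ∼ e) F → 𝔖 N u e ≢ 0ℤ
    present q = F-positive q ∘ trans (F≡𝔖 _)

    mono210 : 𝔖 N u (mono 2 1 0) ≢ 0ℤ
    mono210 = present (here (same refl))

    mono201 : 𝔖 N u (mono 2 0 1) ≢ 0ℤ
    mono201 = present (there (here (same refl)))

    mono021 : 𝔖 N u (mono 0 2 1) ≢ 0ℤ
    mono021 = present (there (there (there (there (here (same refl))))))

    tail≤code : ∀ k {e e′} → 𝔖 N u e ≢ 0ℤ → e′ ∼ code u → tail k e ℤ.≤ tail k e′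
    tail≤code k {e} nz q = subst (tail k e ℤ.≤_)
      (trans (sym (tail-code k u)) (sym (tail-∼ k q))) (𝔖-tail N k u e nz)

    -- `code u` occurs in `F` and dominates `mono 2 1 0` in every tail degree; each of the other
    -- four monomials falls short in the degree from x₂ or from x₃ on.
    code-u : mono 2 1 0 ∼ code u
    code-u with support (λ z → contradiction (trans (sym (𝔖-code N _ u refl u-length)) z) λ ())
    ... | here q = q
    ... | there (here q) =
      contradiction (minus-antitone c (sumE ρ) 0 1 (tail≤code 2 mono210 q)) λ ()
    ... | there (there (here q)) =
      contradiction (minus-antitone b (c - 0ℤ + sumE ρ) 1 2 (tail≤code 1 mono210 q)) λ { (s≤s ()) }
    ... | there (there (there (here q))) =
      contradiction (minus-antitone c (sumE ρ) 0 1 (tail≤code 2 mono210 q)) λ ()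
    ... | there (there (there (there (here q)))) =
      contradiction (minus-antitone c (sumE ρ) 0 1 (tail≤code 2 mono210 q)) λ ()

    -- Only `mono 2 1 0` and `mono 2 0 1` have x₁-exponent a - 2; the two alternatives compare
    -- x₃-exponents.
    exch-mono201 : 𝔖 N u (exch 1 (mono 2 0 1)) ≢ 0ℤ → c ≡ b ⊎ c - 1ℤ ≡ b
    exch-mono201 nz with support nz
    ... | here q = inj₁ (trans (sym (ℤP.+-identityʳ c)) (trans (∼⇒get q 2) (ℤP.+-identityʳ b)))
    ... | there (here q) = inj₂ (trans (∼⇒get q 2) (ℤP.+-identityʳ b))
    ... | there (there (here q)) = contradiction (minus-injective a 1 2 (∼⇒get q 0)) λ ()
    ... | there (there (there (here q))) = contradiction (minus-injective a 1 2 (∼⇒get q 0)) λ ()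
    ... | there (there (there (there (here q)))) =
      contradiction (minus-injective a 0 2 (∼⇒get q 0)) λ ()

    exch-mono021 : 𝔖 N u (exch 1 (mono 0 2 1)) ≢ 0ℤ → c - 1ℤ ≡ b - pos 2
    exch-mono021 nz with support nz
    ... | here q         = contradiction (minus-injective a 2 0 (∼⇒get q 0)) λ ()
    ... | there (here q) = contradiction (minus-injective a 2 0 (∼⇒get q 0)) λ ()
    ... | there (there (here q)) = contradiction (minus-injective a 1 0 (∼⇒get q 0)) λ ()
    ... | there (there (there (here q))) = contradiction (minus-injective a 1 0 (∼⇒get q 0)) λ ()
    ... | there (there (there (there (here q)))) = ∼⇒get q 2

    -- Excludes lists with fewer than three entries. The entry is c, and `mono 2 0 1` has
    -- x₃-exponent c - 1 ≥ 0.
    get-code₂≢0 : get (code u) 2 ≢ 0ℤ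
    get-code₂≢0 z =
      contradiction (subst (λ t → 0ℤ ℤ.≤ t - 1ℤ) c≡0 (𝔖-nonneg N 2 u (mono 2 0 1) mono201)) λ ()
      where
      c≡0 : c ≡ 0ℤ
      c≡0 = trans (sym (ℤP.+-identityʳ c)) (trans (∼⇒get code-u 2) z)

  not-Schubert : ∀ u → ¬ (∀ e → coeff F e ≡ 𝔖 (length u ∸ 1) u e)
  not-Schubert []           h = Support.get-code₂≢0 0 [] h z≤n refl
  not-Schubert (x ∷ [])     h = Support.get-code₂≢0 0 (x ∷ []) h ℕP.≤-refl refl
  not-Schubert (x ∷ y ∷ []) h = Support.get-code₂≢0 1 (x ∷ y ∷ []) h ℕP.≤-refl refl
  not-Schubert u@(x ∷ y ∷ z ∷ r) h with z <ᵇ y in d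
  -- Without a descent in position 2, 𝔖 is symmetric in x₂ and x₃; the exchanges of `mono 0 2 1` and
  -- `mono 2 0 1` then force c = b - 1 and c ≥ b.
  ... | false = clash (exch-mono021 (mono021 ∘ trans (symmetric (mono 0 2 1))))
                      (exch-mono201 (mono201 ∘ trans (symmetric (mono 2 0 1))))
    where
    N = length u ∸ 1
    open Support N u h ℕP.≤-refl
    symmetric : ∀ e → 𝔖 N u e ≡ 𝔖 N u (exch 1 e)
    symmetric e = ℤP.i-j≡0⇒i≡j _ _ (trans (Div-𝔖 {1} {N} (s≤s (s≤s z≤n)) u e)
      (cong (λ t → (if t then 𝔖 N (swapL 1 u) (lower 1 e) else 0ℤ)
                 - (if t then 𝔖 N (swapL 1 u) (lower 2 e) else 0ℤ)) d))
    clash : c - 1ℤ ≡ b - pos 2 → c ≡ b ⊎ c - 1ℤ ≡ b → ⊥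
    clash p (inj₁ q) =
      contradiction (minus-injective b 1 2 (trans (cong (_- 1ℤ) (sym q)) p)) λ ()
    clash p (inj₂ q) =
      contradiction (minus-injective b 0 2 (trans (ℤP.+-identityʳ b) (trans (sym q) p))) λ ()
  -- At `e`, the exchange of `mono 2 0 1`, both terms from `u′` vanish, so `e` occurs in `F` and c ≥
  -- b; but the code of u gives c ≤ b - 2.
  ... | true = clash (exch-mono201 (mono201 ∘ trans (sym 𝔖u≡)))
    where
    open ≡-Reasoning
    N = length u ∸ 1
    open Support N u h ℕP.≤-refl
    u′ = x ∷ z ∷ y ∷ r
    e = exch 1 (mono 2 0 1)
    b-1≡ : b - 1ℤ ≡ pos (suc (cnt y r))
    b-1≡ = trans (∼⇒get code-u 1) (cong (λ t → pos ((if t then 1 else 0) ℕ.+ cnt y r)) d)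
    b≡ : b ≡ pos (2 ℕ.+ cnt y r)
    b≡ = trans (cancel b) (cong (1ℤ +_) b-1≡)
      where
      cancel : ∀ (b : ℤ) → b ≡ 1ℤ + (b - 1ℤ)
      cancel = solve-∀
    c≡ : c ≡ pos (cnt z r)
    c≡ = trans (sym (ℤP.+-identityʳ c)) (∼⇒get code-u 2)
    u′-tail : pos (inv (drop 2 u′)) ≡ b - pos 2 + sumE ρ
    u′-tail = cong₂ _+_ (sym (trans (cong (_- pos 2) b≡) (cancel (pos (cnt y r)))))
      (trans (sym (tail-code 0 r)) (sym (tail-∼ 3 code-u)))
      where
      cancel : ∀ (t : ℤ) → 1ℤ + 1ℤ + t - (1ℤ + 1ℤ) ≡ t
      cancel = solve-∀
    -- The bound for `u′` allows b - 2 plus the degree of `ρ`; the two monomials have x₃-exponent b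
    -- - p with p = 0, 1 and the same `ρ`.
    vanish : ∀ e p → p < 2 → tail 2 e ≡ b - pos p + sumE ρ → 𝔖 N u′ e ≡ 0ℤ
    vanish e p p<2 t = decidable-stable (𝔖 N u′ e ℤ.≟ 0ℤ) λ nz →
      ℕP.<⇒≱ p<2 (minus-antitone b (sumE ρ) p 2 (subst₂ ℤ._≤_ t u′-tail (𝔖-tail N 2 u′ e nz)))
    𝔖u≡ : 𝔖 N u e ≡ 𝔖 N u (mono 2 0 1)
    𝔖u≡ = ℤP.i-j≡0⇒i≡j _ _ (begin
      𝔖 N u e - 𝔖 N u (mono 2 0 1)
        ≡⟨ Div-𝔖 {1} {N} (s≤s (s≤s z≤n)) u e ⟩
      R 1 (𝔖 N) u (lower 1 e) - R 1 (𝔖 N) u (lower 2 e)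
        ≡⟨ cong (λ t → (if t then 𝔖 N u′ (lower 1 e) else 0ℤ)
                     - (if t then 𝔖 N u′ (lower 2 e) else 0ℤ)) d ⟩
      𝔖 N u′ (lower 1 e) - 𝔖 N u′ (lower 2 e)
        ≡⟨ cong₂ _-_ (vanish (lower 1 e) 0 (s≤s z≤n) refl)
             (vanish (lower 2 e) 1 ℕP.≤-refl
               (cong (λ t → t - 1ℤ + sumE ρ) (ℤP.+-identityʳ b))) ⟩
      0ℤ ∎)
    z≤y : cnt z r ≤ cnt y r
    z≤y = cnt-mono (<ᵇ⇒≤ z y d) r
    clash : c ≡ b ⊎ c - 1ℤ ≡ b → ⊥
    clash (inj₁ q) = ℕP.<⇒≱ (s≤s (ℕP.m≤n⇒m≤1+n z≤y))
      (ℕP.≤-reflexive (ℤP.+-injective (trans (sym b≡) (trans (sym q) c≡))))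
    clash (inj₂ q) = ℕP.<⇒≱ (ℕP.m≤n⇒m≤1+n (s≤s (ℕP.m≤n⇒m≤1+n z≤y)))
      (ℕP.≤-reflexive (ℤP.+-injective
        (trans (cong (1ℤ +_) (trans (sym b≡) (sym q))) (trans (cancel c) c≡))))
      where
      cancel : ∀ (c : ℤ) → 1ℤ + (c - 1ℤ) ≡ c
      cancel = solve-∀

theorem3p1 : (n : ℕ) → 4 ≤ n → (μ : Vec ℕ n) →
    (u : List ℕ) (P : Poly) → Schubert u P →
    ¬ (twist (toMono μ) S1432 ≈ P)
-- With the leading exponents exposed, `twist` computes to `F`.
theorem3p1 _ (s≤s (s≤s (s≤s (s≤s _)))) (a ∷ b ∷ c ∷ d ∷ ρ) u P sch eq =
  Reciprocal.not-Schubert (pos a) (pos b) (pos c) (pos d ∷ toMono ρ) u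
    (λ e → trans (eq e) (Schubert-𝔖 sch e))
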